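{- There are only finitely many squarefree integers $D\ge 2$ such that the real quadratic field $K=\mathbb{Q}(\sqrt{D})$ admits a binary or ternary $\mathbb{Z}$-universal generalized quadratic form.
   Context: $\mathcal{O}_K$ is the ring of integers of $K$ and $\tau: K\to K$, $a+b\sqrt{D}\mapsto a-b\sqrt{D}$. A generalized quadratic form in $n$ variables over $K$ is an expression $G(z_1,\dots,z_n)=\sum_{1\le i\le j\le n}\alpha_{ij}z_iz_j+\sum_{1\le i,j\le n}\beta_{ij}z_i\tau(z_j)+\sum_{1\le i\le j\le n}\gamma_{ij}\tau(z_i)\tau(z_j)$ with coefficients in $K$, evaluated at $\mathbf{a}\in K^n$ by substituting $a_i$ for $z_i$ and $\tau(a_i)$ for $\tau(z_i)$. Binary/ternary means $n=2$/$n=3$. $G$ is integral if all coefficients lie in $\mathcal{O}_K$; $\mathbb{Z}$-valued if $G(\mathbf{a})\in\mathbb{Z}$ for all $\mathbf{a}\in\mathcal{O}_K^n$; positive definite if $G(\mathbf{a})>0$ for all nonzero $\mathbf{a}\in K^n$; $\mathbb{Z}$-universal if positive definite, integral, $\mathbb{Z}$-valued, and every positive integer equals $G(\mathbf{a})$ for some $\mathbf{a}\in\mathcal{O}_K^n$. -}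

module Defs where

open import Data.Nat as ℕ using (ℕ; _%_; _≡ᵇ_)
open import Data.Nat.Divisibility using (_∣_)
open import Data.Integer as ℤ using (ℤ)
open import Data.Rational as ℚ using (ℚ; 0ℚ; 1ℚ; ½; _/_)
open import Data.Fin as Fin using (Fin; zero; suc)
open import Data.Bool using (if_then_else_)
open import Data.Product using (_×_; _,_; ∃; ∃-syntax; Σ)
open import Data.Sum using (_⊎_)
open import Relation.Nullary using (¬_; yes; no)
open import Relation.Binary.PropositionalEquality using (_≡_)

SquareFree : ℕ → Set
SquareFree d = ∀ (m : ℕ) → (m ℕ.* m) ∣ d → m ≡ 1

-- Elements of K = ℚ(√D):  (a , b)  represents  a + b √D.
K : Set
K = ℚ × ℚ

module QuadField (D : ℕ) where

  Dℚ : ℚ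
  Dℚ = ℤ.+ D / 1

  0K : K
  0K = (0ℚ , 0ℚ)

  fromℤ : ℤ → K
  fromℤ z = (z / 1 , 0ℚ)

  infixl 6 _+K_
  infixl 7 _*K_

  _+K_ : K → K → K
  (a , b) +K (c , d) = (a ℚ.+ c , b ℚ.+ d)

  _*K_ : K → K → K
  (a , b) *K (c , d) = (a ℚ.* c ℚ.+ b ℚ.* d ℚ.* Dℚ , a ℚ.* d ℚ.+ b ℚ.* c)

  τ : K → K
  τ (a , b) = (a , ℚ.- b)

  ω : K
  ω = if D % 4 ≡ᵇ 1 then (½ , ½) else (0ℚ , 1ℚ)

  InOK : K → Set
  InOK x = ∃[ m ] ∃[ n ] (x ≡ fromℤ m +K (fromℤ n *K ω))

  InZ : K → Set
  InZ x = ∃[ z ] (x ≡ fromℤ z)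

  -- x > 0 in the real embedding with √D > 0, i.e. a + b√D > 0
  Positive : K → Set
  Positive (a , b) =
      (0ℚ ℚ.< a × 0ℚ ℚ.≤ b)
    ⊎ (0ℚ ℚ.≤ a × 0ℚ ℚ.< b)
    ⊎ (0ℚ ℚ.< a × b ℚ.< 0ℚ × b ℚ.* b ℚ.* Dℚ ℚ.< a ℚ.* a)
    ⊎ (a ℚ.< 0ℚ × 0ℚ ℚ.< b × a ℚ.* a ℚ.< b ℚ.* b ℚ.* Dℚ)

  sumK : ∀ {n} → (Fin n → K) → K
  sumK {ℕ.zero} f = 0K
  sumK {ℕ.suc n} f = f zero +K sumK (λ i → f (suc i))

  sumTri : ∀ {n} → (Fin n → Fin n → K) → K
  sumTri f = sumK (λ i → sumK (λ j → tri i j))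
    where
    tri : _ → _ → K
    tri i j with i Fin.≤? j
    ... | yes _ = f i j
    ... | no _ = 0K

  -- A generalized quadratic form in n variables:
  --   Σ_{i≤j} α_ij z_i z_j + Σ_{i,j} β_ij z_i τ(z_j) + Σ_{i≤j} γ_ij τ(z_i) τ(z_j)
  -- (entries α i j, γ i j with i > j are not used).
  record GQF (n : ℕ) : Set where
    field
      α β γ : Fin n → Fin n → K

  eval : ∀ {n} → GQF n → (Fin n → K) → K
  eval G a =
    sumTri (λ i j → GQF.α G i j *K (a i *K a j))
    +K sumK (λ i → sumK (λ j → GQF.β G i j *K (a i *K τ (a j))))
    +K sumTri (λ i j → GQF.γ G i j *K (τ (a i) *K τ (a j)))

  Integral : ∀ {n} → GQF n → Set
  Integral G = (∀ i j → i Fin.≤ j → InOK (GQF.α G i j))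
             × (∀ i j → InOK (GQF.β G i j))
             × (∀ i j → i Fin.≤ j → InOK (GQF.γ G i j))

  ZValued : ∀ {n} → GQF n → Set
  ZValued G = ∀ a → (∀ i → InOK (a i)) → InZ (eval G a)

  PositiveDefinite : ∀ {n} → GQF n → Set
  PositiveDefinite G = ∀ a → ¬ (∀ i → a i ≡ 0K) → Positive (eval G a)

  ZUniversal : ∀ {n} → GQF n → Set
  ZUniversal G = PositiveDefinite G × Integral G × ZValued G
    × (∀ (m : ℕ) → 1 ℕ.≤ m →
         ∃[ a ] ((∀ i → InOK (a i)) × eval G a ≡ fromℤ (ℤ.+ m)))

AdmitsZUniversal : ℕ → ℕ → Set
AdmitsZUniversal D n = Σ (QuadField.GQF D n) (QuadField.ZUniversal D)

{-# OPTIONS --safe #-}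

-- On O_K^n the form is a positive definite integral quadratic form F over ℤ, with polar form B.
-- Reduction modulo √D sends ℤ[√D] onto ℤ/D and is invariant under τ, so up to a power of 2 the
-- form B factors modulo D through n ≤ 3 coordinates. Hence the Gram determinant of any four
-- vectors is divisible by D up to a power of 2, and it remains to find four independent vectors of
-- bounded norm. This is done by escalation: choose vectors of norms 1, 2, t and t′, where t (resp. t′)
-- is a number that the span of the vectors chosen before does not represent. Only finitely many Gram
-- matrices occur, so suitable t and t′ are found by a finite search.
module Submission where

-- A positive definite ternary form over ℚ is anisotropic at some prime p, so it misses a whole
-- square class of ℚ_p and hence some positive integers. This is why a suitable t′ exists for every
-- choice of three vectors. Dependence is tested through inner products: for a vector in the
-- rational span of the chosen ones, the weighted squares of its integral products with the
-- orthogonalised vectors add up to its norm. The search therefore runs over integer equations and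
-- not over lattice bases or reduced forms. Positivity of the Gram determinants also comes from the
-- search: they are nonnegative because `B` is, and zero is excluded because the corresponding
-- equation has no solution. Gram-Schmidt is carried out with cleared denominators, so the number
-- shown to be divisible by D is a multiple of the Gram determinant, which enlarges the final bound.

open import Defs
open import Level using (0ℓ)
open import Algebra.Bundles using (CommutativeRing)
import Algebra.Solver.Ring.NaturalCoefficients.Default as NaturalCoefficients
open import Data.Bool using (true; false)
open import Data.Fin as Fin using (Fin; zero; suc)
open import Data.Fin.Patterns using (0F; 1F; 2F; 3F)
import Data.Fin.Properties as FinP
open import Data.Integer as ℤ using (ℤ; +_)
open import Data.Integer.Divisibility.Signed using (_∣_; divides; ∣m∣n⇒∣m+n; ∣m∣n⇒∣m-n; ∣m⇒∣-m; ∣n⇒∣m*n; ∣m⇒∣m*n; ∣⇒∣ᵤ)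
import Data.Integer.Properties as ℤP
open import Data.Integer.Tactic.RingSolver using (solve-∀)
open import Data.Nat using (ℕ; _≤_)
open import Data.Nat as ℕ using (_≡ᵇ_; _%_)
import Data.Nat.Divisibility as ℕD
import Data.Nat.Properties as ℕP
open import Data.Product using (_×_; _,_; ∃-syntax; Σ; proj₁; proj₂)
open import Data.Rational as ℚ using (ℚ; 0ℚ; 1ℚ; ½)
open import Data.Rational.Literals using () renaming (fromℤ to embed)
import Data.Rational.Properties as ℚP
open import Data.Rational.Solver using (module +-*-Solver)
open import Data.Sum using (_⊎_; inj₁; inj₂; [_,_]′)
open import Data.Unit using (tt)
open import Relation.Binary.Definitions using (tri<; tri≈; tri>)
open import Relation.Binary.PropositionalEquality
open import Algebra.Structures {A = K} _≡_ using (IsCommutativeRing)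
open import Relation.Nullary using (yes; no; contradiction)
open import Algebra.Properties.Semiring.Sum (CommutativeRing.semiring ℤP.+-*-commutativeRing)
  using (sum; ∑-comm; *-distribˡ-sum; ∑-distrib-+; sum-cong-≗)

-- No module laws are required of V, as only the values of B matter. The maps φ and ψ say that
-- 8 B has rank at most n modulo D.
record Lattice (D n : ℕ) : Set₁ where
  infixl 6 _⊕_
  infixr 7 _⊙_
  field
    V : Set
    _⊕_ : V → V → V
    _⊙_ : ℤ → V → V
    B : V → V → ℤ
    B-sym : ∀ v w → B v w ≡ B w v
    B-⊕ : ∀ u v w → B (u ⊕ v) w ≡ B u w ℤ.+ B v w
    B-⊙ : ∀ c v w → B (c ⊙ v) w ≡ c ℤ.* B v w
    B-nonneg : ∀ v → + 0 ℤ.≤ B v v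
    B-universal : ∀ m → 1 ℕ.≤ m → ∃[ v ] B v v ≡ + 2 ℤ.* + m
    φ ψ : V → Fin n → ℤ
    B-residue : ∀ v w → + D ∣ + 8 ℤ.* B v w ℤ.- sum (λ i → φ v i ℤ.* ψ w i)

-- Rank at most 2 is a case of rank at most 3, so the escalation treats three coordinates only. The
-- appended summand computes to 0, which lets `B-residue` carry over unchanged.
pad : ∀ {D} → Lattice D 2 → Lattice D 3
pad L = record
  { V = V ; _⊕_ = _⊕_ ; _⊙_ = _⊙_ ; B = B
  ; B-sym = B-sym ; B-⊕ = B-⊕ ; B-⊙ = B-⊙ ; B-nonneg = B-nonneg ; B-universal = B-universal
  ; φ = λ v → append-0 (φ v) ; ψ = λ v → append-0 (ψ v)
  ; B-residue = B-residue }
  where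
  open Lattice L
  append-0 : (Fin 2 → ℤ) → Fin 3 → ℤ
  append-0 x 0F = x 0F
  append-0 x 1F = x 1F
  append-0 x 2F = + 0

-- Integers inside the rationals

ι : ℤ → ℚ
ι z = z ℚ./ 1

-- The quotient `z / 1` is normalised by a gcd and is stuck on an open `z`, whereas `embed z` is a
-- fraction already in lowest terms, on which arithmetic computes.
ι≡embed : ∀ z → ι z ≡ embed z
ι≡embed z = ℚP.↥p/↧p≡p (embed z)

ι-injective : ∀ {a b} → ι a ≡ ι b → a ≡ b
ι-injective {a} {b} e = cong ℚ.↥_ (trans (sym (ι≡embed a)) (trans e (ι≡embed b)))

ι-+ : ∀ a b → ι (a ℤ.+ b) ≡ ι a ℚ.+ ι b
ι-+ a b = trans (cong₂ (λ x y → ι (x ℤ.+ y)) (sym (ℤP.*-identityʳ a)) (sym (ℤP.*-identityʳ b)))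
  (cong₂ ℚ._+_ (sym (ι≡embed a)) (sym (ι≡embed b)))

ι-* : ∀ a b → ι (a ℤ.* b) ≡ ι a ℚ.* ι b
ι-* a b = cong₂ ℚ._*_ (sym (ι≡embed a)) (sym (ι≡embed b))

ι-neg : ∀ a → ι (ℤ.- a) ≡ ℚ.- ι a
ι-neg a = trans (ι≡embed (ℤ.- a)) (trans (embed-neg a) (cong ℚ.-_ (sym (ι≡embed a))))
  where
  embed-neg : ∀ a → embed (ℤ.- a) ≡ ℚ.- embed a
  embed-neg (+ ℕ.zero) = refl
  embed-neg (+ ℕ.suc n) = refl
  embed-neg ℤ.-[1+ n ] = refl

0<ι⇒0< : ∀ {z} → 0ℚ ℚ.< ι z → + 0 ℤ.< z
0<ι⇒0< {z} p = subst (+ 0 ℤ.<_) (ℤP.*-identityʳ z) (ℚP.drop-*<* (subst (0ℚ ℚ.<_) (ι≡embed z) p))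

-- Exchanging the order of summation in the second double sum transposes `S`. The result is one
-- product per coordinate, the shape in which `Lattice` records that the rank is at most n.
symmetrize : ∀ {n} (S : Fin n → Fin n → ℤ) (x y : Fin n → ℤ) →
  sum (λ i → sum (λ j → S i j ℤ.* (x i ℤ.* y j))) ℤ.+ sum (λ i → sum (λ j → S i j ℤ.* (y i ℤ.* x j)))
  ≡ sum (λ i → x i ℤ.* sum (λ j → (S i j ℤ.+ S j i) ℤ.* y j))
symmetrize S x y = begin
  sum (λ i → sum (a i)) ℤ.+ sum (λ i → sum (b i))          ≡⟨ cong (λ z → sum (λ i → sum (a i)) ℤ.+ z) (∑-comm b) ⟩
  sum (λ i → sum (a i)) ℤ.+ sum (λ i → sum (λ j → b j i))  ≡⟨ ∑-distrib-+ (λ i → sum (a i)) (λ i → sum (λ j → b j i)) ⟨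
  sum (λ i → sum (a i) ℤ.+ sum (λ j → b j i))              ≡⟨ sum-cong-≗ (λ i → begin
      sum (a i) ℤ.+ sum (λ j → b j i)                ≡⟨ ∑-distrib-+ (a i) (λ j → b j i) ⟨
      sum (λ j → a i j ℤ.+ b j i)                    ≡⟨ sum-cong-≗ (λ j → regroup (S i j) (S j i) (x i) (y j)) ⟩
      sum (λ j → x i ℤ.* ((S i j ℤ.+ S j i) ℤ.* y j)) ≡⟨ *-distribˡ-sum (x i) (λ j → (S i j ℤ.+ S j i) ℤ.* y j) ⟨
      x i ℤ.* sum (λ j → (S i j ℤ.+ S j i) ℤ.* y j)  ∎) ⟩
  sum (λ i → x i ℤ.* sum (λ j → (S i j ℤ.+ S j i) ℤ.* y j)) ∎
  where
  open ≡-Reasoning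
  a b : _ → _ → ℤ
  a i j = S i j ℤ.* (x i ℤ.* y j)
  b i j = S i j ℤ.* (y i ℤ.* x j)
  regroup : ∀ s t x y → s ℤ.* (x ℤ.* y) ℤ.+ t ℤ.* (y ℤ.* x) ≡ x ℤ.* ((s ℤ.+ t) ℤ.* y)
  regroup = solve-∀

-- ℚ(√D) as a commutative ring with involution

module Field (D : ℕ) where
  open QuadField D
  private module Q = +-*-Solver

  -K_ : K → K
  -K (a , b) = (ℚ.- a , ℚ.- b)

  1K : K
  1K = fromℤ (+ 1)

  *K-assoc : ∀ x y z → (x *K y) *K z ≡ x *K (y *K z)
  *K-assoc (a , b) (c , d) (e , f) = cong₂ _,_
    (Q.solve 7 (λ a b c d e f D → (a Q.:* c Q.:+ b Q.:* d Q.:* D) Q.:* e Q.:+ (a Q.:* d Q.:+ b Q.:* c) Q.:* f Q.:* D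
                             Q.:= a Q.:* (c Q.:* e Q.:+ d Q.:* f Q.:* D) Q.:+ b Q.:* (c Q.:* f Q.:+ d Q.:* e) Q.:* D) refl a b c d e f Dℚ)
    (Q.solve 7 (λ a b c d e f D → (a Q.:* c Q.:+ b Q.:* d Q.:* D) Q.:* f Q.:+ (a Q.:* d Q.:+ b Q.:* c) Q.:* e
                             Q.:= a Q.:* (c Q.:* f Q.:+ d Q.:* e) Q.:+ b Q.:* (c Q.:* e Q.:+ d Q.:* f Q.:* D)) refl a b c d e f Dℚ)

  *K-comm : ∀ x y → x *K y ≡ y *K x
  *K-comm (a , b) (c , d) = cong₂ _,_
    (Q.solve 5 (λ a b c d D → a Q.:* c Q.:+ b Q.:* d Q.:* D Q.:= c Q.:* a Q.:+ d Q.:* b Q.:* D) refl a b c d Dℚ)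
    (Q.solve 4 (λ a b c d → a Q.:* d Q.:+ b Q.:* c Q.:= c Q.:* b Q.:+ d Q.:* a) refl a b c d)

  *K-identityˡ : ∀ x → 1K *K x ≡ x
  *K-identityˡ (a , b) = cong₂ _,_
    (Q.solve 3 (λ a b D → Q.con 1ℚ Q.:* a Q.:+ Q.con 0ℚ Q.:* b Q.:* D Q.:= a) refl a b Dℚ)
    (Q.solve 2 (λ a b → Q.con 1ℚ Q.:* b Q.:+ Q.con 0ℚ Q.:* a Q.:= b) refl a b)

  *K-distribʳ : ∀ x y z → (y +K z) *K x ≡ (y *K x) +K (z *K x)
  *K-distribʳ (a , b) (c , d) (e , f) = cong₂ _,_
    (Q.solve 7 (λ a b c d e f D → (c Q.:+ e) Q.:* a Q.:+ (d Q.:+ f) Q.:* b Q.:* D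
                             Q.:= (c Q.:* a Q.:+ d Q.:* b Q.:* D) Q.:+ (e Q.:* a Q.:+ f Q.:* b Q.:* D)) refl a b c d e f Dℚ)
    (Q.solve 6 (λ a b c d e f → (c Q.:+ e) Q.:* b Q.:+ (d Q.:+ f) Q.:* a
                           Q.:= (c Q.:* b Q.:+ d Q.:* a) Q.:+ (e Q.:* b Q.:+ f Q.:* a)) refl a b c d e f)

  K-isCommutativeRing : IsCommutativeRing _+K_ _*K_ -K_ 0K 1K
  K-isCommutativeRing = record
    { isRing = record
      { +-isAbelianGroup = record
        { isGroup = record
          { isMonoid = record
            { isSemigroup = record
              { isMagma = record { isEquivalence = isEquivalence ; ∙-cong = cong₂ _+K_ }
              ; assoc = λ (a , b) (c , d) (e , f) → cong₂ _,_ (ℚP.+-assoc a c e) (ℚP.+-assoc b d f) }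
            ; identity = (λ (a , b) → cong₂ _,_ (ℚP.+-identityˡ a) (ℚP.+-identityˡ b))
                       , (λ (a , b) → cong₂ _,_ (ℚP.+-identityʳ a) (ℚP.+-identityʳ b)) }
          ; inverse = (λ (a , b) → cong₂ _,_ (ℚP.+-inverseˡ a) (ℚP.+-inverseˡ b))
                    , (λ (a , b) → cong₂ _,_ (ℚP.+-inverseʳ a) (ℚP.+-inverseʳ b))
          ; ⁻¹-cong = cong -K_ }
        ; comm = λ (a , b) (c , d) → cong₂ _,_ (ℚP.+-comm a c) (ℚP.+-comm b d) }
      ; *-cong = cong₂ _*K_
      ; *-assoc = *K-assoc
      ; *-identity = *K-identityˡ , (λ x → trans (*K-comm x 1K) (*K-identityˡ x))
      ; distrib = (λ x y z → trans (*K-comm x (y +K z))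
                    (trans (*K-distribʳ x y z) (cong₂ _+K_ (*K-comm y x) (*K-comm z x))))
                , *K-distribʳ }
    ; *-comm = *K-comm }

  K-commutativeRing : CommutativeRing 0ℓ 0ℓ
  K-commutativeRing = record { isCommutativeRing = K-isCommutativeRing }

  open CommutativeRing K-commutativeRing using (distribˡ; zeroˡ; zeroʳ)
  private module KS = NaturalCoefficients (CommutativeRing.commutativeSemiring K-commutativeRing)

  fromℤ-+ : ∀ a b → fromℤ (a ℤ.+ b) ≡ fromℤ a +K fromℤ b
  fromℤ-+ a b = cong (_, 0ℚ) (ι-+ a b)

  fromℤ-* : ∀ a b → fromℤ (a ℤ.* b) ≡ fromℤ a *K fromℤ b
  fromℤ-* a b = cong₂ _,_
    (trans (ι-* a b) (Q.solve 3 (λ a b D → a Q.:* b Q.:= a Q.:* b Q.:+ Q.con 0ℚ Q.:* Q.con 0ℚ Q.:* D) refl (ι a) (ι b) Dℚ))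
    (Q.solve 2 (λ a b → Q.con 0ℚ Q.:= a Q.:* Q.con 0ℚ Q.:+ Q.con 0ℚ Q.:* b) refl (ι a) (ι b))

  fromℤ-injective : ∀ {a b} → fromℤ a ≡ fromℤ b → a ≡ b
  fromℤ-injective e = ι-injective (cong proj₁ e)

  τ-+ : ∀ x y → τ (x +K y) ≡ τ x +K τ y
  τ-+ (a , b) (c , d) = cong (a ℚ.+ c ,_) (ℚP.neg-distrib-+ b d)

  τ-fromℤ* : ∀ c x → τ (fromℤ c *K x) ≡ fromℤ c *K τ x
  τ-fromℤ* c (a , b) = cong₂ _,_
    (Q.solve 4 (λ c a b D → c Q.:* a Q.:+ Q.con 0ℚ Q.:* b Q.:* D Q.:= c Q.:* a Q.:+ Q.con 0ℚ Q.:* (Q.:- b) Q.:* D) refl (ι c) a b Dℚ)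
    (Q.solve 3 (λ c a b → Q.:- (c Q.:* b Q.:+ Q.con 0ℚ Q.:* a) Q.:= c Q.:* (Q.:- b) Q.:+ Q.con 0ℚ Q.:* a) refl (ι c) a b)

  sumK-cong : ∀ {n} {f g : Fin n → K} → (∀ i → f i ≡ g i) → sumK f ≡ sumK g
  sumK-cong {ℕ.zero} e = refl
  sumK-cong {ℕ.suc n} e = cong₂ _+K_ (e zero) (sumK-cong (λ i → e (suc i)))

  sumK-+ : ∀ {n} (f g : Fin n → K) → sumK (λ i → f i +K g i) ≡ sumK f +K sumK g
  sumK-+ {ℕ.zero} f g = refl
  sumK-+ {ℕ.suc n} f g = trans (cong (f zero +K g zero +K_) (sumK-+ (λ i → f (suc i)) (λ i → g (suc i))))
    (KS.solve 4 (λ a b c d → (a :+ b) :+ (c :+ d) := (a :+ c) :+ (b :+ d)) refl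
      (f zero) (g zero) (sumK (λ i → f (suc i))) (sumK (λ i → g (suc i))))
    where open KS

  sumK-* : ∀ {n} c (f : Fin n → K) → sumK (λ i → c *K f i) ≡ c *K sumK f
  sumK-* {ℕ.zero} c f = sym (zeroʳ c)
  sumK-* {ℕ.suc n} c f = trans (cong (c *K f zero +K_) (sumK-* c (λ i → f (suc i))))
    (sym (distribˡ c (f zero) (sumK (λ i → f (suc i)))))

  sumK₂ : ∀ {m n} → (Fin m → Fin n → K) → K
  sumK₂ f = sumK (λ i → sumK (f i))

  sumK₂-cong : ∀ {m n} {f g : Fin m → Fin n → K} → (∀ i j → f i j ≡ g i j) → sumK₂ f ≡ sumK₂ g
  sumK₂-cong e = sumK-cong (λ i → sumK-cong (e i))

  sumK₂-+ : ∀ {m n} (f g : Fin m → Fin n → K) → sumK₂ (λ i j → f i j +K g i j) ≡ sumK₂ f +K sumK₂ g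
  sumK₂-+ f g = trans (sumK-cong (λ i → sumK-+ (f i) (g i))) (sumK-+ (λ i → sumK (f i)) (λ i → sumK (g i)))

  sumK₂-* : ∀ {m n} c (f : Fin m → Fin n → K) → sumK₂ (λ i j → c *K f i j) ≡ c *K sumK₂ f
  sumK₂-* c f = trans (sumK-cong (λ i → sumK-* c (f i))) (sumK-* c (λ i → sumK (f i)))

  -- Integral elements and their residues modulo √D

  InOK-+ : ∀ {x y} → InOK x → InOK y → InOK (x +K y)
  InOK-+ (m , n , refl) (m′ , n′ , refl) = m ℤ.+ m′ , n ℤ.+ n′ ,
    trans (KS.solve 5 (λ m n m′ n′ w → (m :+ n :* w) :+ (m′ :+ n′ :* w) := (m :+ m′) :+ (n :+ n′) :* w)
        refl (fromℤ m) (fromℤ n) (fromℤ m′) (fromℤ n′) ω)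
      (sym (cong₂ (λ a b → a +K b *K ω) (fromℤ-+ m m′) (fromℤ-+ n n′)))
    where open KS

  InOK-* : ∀ c {x} → InOK x → InOK (fromℤ c *K x)
  InOK-* c (m , n , refl) = c ℤ.* m , c ℤ.* n ,
    trans (KS.solve 4 (λ c m n w → c :* (m :+ n :* w) := c :* m :+ c :* n :* w) refl (fromℤ c) (fromℤ m) (fromℤ n) ω)
      (sym (cong₂ (λ a b → a +K b *K ω) (fromℤ-* c m) (fromℤ-* c n)))
    where open KS

  -- k x lies in ℤ[√D] and is congruent to r modulo √D.
  HasResidue : ℤ → K → ℤ → Set
  HasResidue k x r = ∃[ p ] ∃[ q ] (fromℤ k *K x ≡ (ι p , ι q)) × (+ D ∣ p ℤ.- r)

  residue-+ : ∀ {k x y r s} → HasResidue k x r → HasResidue k y s → HasResidue k (x +K y) (r ℤ.+ s)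
  residue-+ {k} {x} {y} {r} {s} (p , q , e , divides u h) (p′ , q′ , e′ , divides u′ h′) =
    p ℤ.+ p′ , q ℤ.+ q′ ,
    trans (distribˡ (fromℤ k) x y)
      (trans (cong₂ _+K_ e e′) (sym (cong₂ _,_ (ι-+ p p′) (ι-+ q q′)))) ,
    divides (u ℤ.+ u′) (trans (regroup p p′ r s) (trans (cong₂ ℤ._+_ h h′) (sym (ℤP.*-distribʳ-+ (+ D) u u′))))
    where
    regroup : ∀ p p′ r s → p ℤ.+ p′ ℤ.- (r ℤ.+ s) ≡ (p ℤ.- r) ℤ.+ (p′ ℤ.- s)
    regroup = solve-∀

  -- The two √D parts multiply to q q′ D, a multiple of D, so the rational part of a product depends
  -- modulo D only on the rational parts of the factors.
  residue-* : ∀ {k l x y r s} → HasResidue k x r → HasResidue l y s → HasResidue (k ℤ.* l) (x *K y) (r ℤ.* s)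
  residue-* {k} {l} {x} {y} {r} {s} (p , q , e , divides u h) (p′ , q′ , e′ , divides u′ h′) =
    p ℤ.* p′ ℤ.+ q ℤ.* q′ ℤ.* + D , p ℤ.* q′ ℤ.+ q ℤ.* p′ ,
    (begin
      fromℤ (k ℤ.* l) *K (x *K y) ≡⟨ cong (_*K (x *K y)) (fromℤ-* k l) ⟩
      (fromℤ k *K fromℤ l) *K (x *K y) ≡⟨ KS.solve 4 (λ k l x y → (k KS.:* l) KS.:* (x KS.:* y) KS.:= (k KS.:* x) KS.:* (l KS.:* y)) refl (fromℤ k) (fromℤ l) x y ⟩
      (fromℤ k *K x) *K (fromℤ l *K y) ≡⟨ cong₂ _*K_ e e′ ⟩
      (ι p , ι q) *K (ι p′ , ι q′) ≡⟨ cong₂ _,_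
          (sym (trans (ι-+ (p ℤ.* p′) (q ℤ.* q′ ℤ.* + D)) (cong₂ ℚ._+_ (ι-* p p′)
            (trans (ι-* (q ℤ.* q′) (+ D)) (cong (ℚ._* Dℚ) (ι-* q q′))))))
          (sym (trans (ι-+ (p ℤ.* q′) (q ℤ.* p′)) (cong₂ ℚ._+_ (ι-* p q′) (ι-* q p′)))) ⟩
      (ι (p ℤ.* p′ ℤ.+ q ℤ.* q′ ℤ.* + D) , ι (p ℤ.* q′ ℤ.+ q ℤ.* p′)) ∎) ,
    divides (u ℤ.* p′ ℤ.+ r ℤ.* u′ ℤ.+ q ℤ.* q′)
      (trans (split p p′ q q′ r s (+ D))
        (trans (cong₂ (λ a b → a ℤ.* p′ ℤ.+ r ℤ.* b ℤ.+ q ℤ.* q′ ℤ.* + D) h h′) (collect u u′ p′ r q q′ (+ D))))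
    where
    open ≡-Reasoning
    split : ∀ p p′ q q′ r s D → p ℤ.* p′ ℤ.+ q ℤ.* q′ ℤ.* D ℤ.- r ℤ.* s
      ≡ (p ℤ.- r) ℤ.* p′ ℤ.+ r ℤ.* (p′ ℤ.- s) ℤ.+ q ℤ.* q′ ℤ.* D
    split = solve-∀
    collect : ∀ u u′ p′ r q q′ D → u ℤ.* D ℤ.* p′ ℤ.+ r ℤ.* (u′ ℤ.* D) ℤ.+ q ℤ.* q′ ℤ.* D
      ≡ (u ℤ.* p′ ℤ.+ r ℤ.* u′ ℤ.+ q ℤ.* q′) ℤ.* D
    collect = solve-∀

  -- Conjugation changes only the √D part. A variable and its conjugate thus share one coordinate
  -- modulo D, which cuts the rank from 2n to n.
  residue-τ : ∀ {k x r} → HasResidue k x r → HasResidue k (τ x) r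
  residue-τ {k} {x} (p , q , e , h) = p , ℤ.- q , trans (sym (τ-fromℤ* k x)) (trans (cong τ e) (cong (ι p ,_) (sym (ι-neg q)))) , h

  residue-fromℤ : ∀ z → HasResidue (+ 1) (fromℤ z) z
  residue-fromℤ z = z , + 0 , *K-identityˡ (fromℤ z) , divides (+ 0) (ℤP.+-inverseʳ z)

  -- The factor 2 clears the denominators of ½ + ½√D; using it for ω = √D as well gives one
  -- multiplier for both cases.
  residue-ω : ∃[ r ] HasResidue (+ 2) ω r
  residue-ω with D % 4 ≡ᵇ 1
  ... | true  = + 1 , + 1 , + 1 , cong (_, ι (+ 1))
    (Q.solve 1 (λ D → Q.con (ι (+ 2)) Q.:* Q.con ½ Q.:+ Q.con 0ℚ Q.:* Q.con ½ Q.:* D Q.:= Q.con 1ℚ) refl Dℚ) , divides (+ 0) refl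
  ... | false = + 0 , + 0 , + 2 , cong (_, ι (+ 2))
    (Q.solve 1 (λ D → Q.con (ι (+ 2)) Q.:* Q.con 0ℚ Q.:+ Q.con 0ℚ Q.:* Q.con 1ℚ Q.:* D Q.:= Q.con 0ℚ) refl Dℚ) , divides (+ 0) refl

  InOK⇒residue : ∀ {x} → InOK x → ∃[ r ] HasResidue (+ 2) x r
  InOK⇒residue (m , n , refl) = _ , residue-+ {+ 2} {fromℤ m} {fromℤ n *K ω} twice
    (residue-* {+ 1} {+ 2} {fromℤ n} {ω} (residue-fromℤ n) (proj₂ residue-ω))
    where
    twice : HasResidue (+ 2) (fromℤ m) (+ 2 ℤ.* m)
    twice = + 2 ℤ.* m , + 0 , sym (fromℤ-* (+ 2) m) , divides (+ 0) (ℤP.+-inverseʳ (+ 2 ℤ.* m))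

  residue-0 : ∀ k → HasResidue k 0K (+ 0)
  residue-0 k = + 0 , + 0 , zeroʳ (fromℤ k) , divides (+ 0) refl

  residue-sum : ∀ {n} k (f : Fin n → K) (r : Fin n → ℤ) → (∀ i → HasResidue k (f i) (r i)) → HasResidue k (sumK f) (sum r)
  residue-sum {ℕ.zero} k f r h = residue-0 k
  residue-sum {ℕ.suc n} k f r h = residue-+ {k} {f zero} (h zero) (residue-sum k (λ i → f (suc i)) (λ i → r (suc i)) (λ i → h (suc i)))

  -- The polarised summands of a generalized form

  pairing : (a b c x y : K) → K
  pairing a b c x y = a *K (x *K y) +K b *K (x *K τ y) +K c *K (τ x *K τ y)

  pairing-+ˡ : ∀ a b c x x′ y → pairing a b c (x +K x′) y ≡ pairing a b c x y +K pairing a b c x′ y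
  pairing-+ˡ a b c x x′ y = trans (cong (λ p → a *K ((x +K x′) *K y) +K b *K ((x +K x′) *K τ y) +K c *K (p *K τ y)) (τ-+ x x′))
    (KS.solve 9 (λ a b c x x′ y p p′ q →
          a :* ((x :+ x′) :* y) :+ b :* ((x :+ x′) :* q) :+ c :* ((p :+ p′) :* q)
          := (a :* (x :* y) :+ b :* (x :* q) :+ c :* (p :* q)) :+ (a :* (x′ :* y) :+ b :* (x′ :* q) :+ c :* (p′ :* q)))
        refl a b c x x′ y (τ x) (τ x′) (τ y))
    where open KS

  pairing-+ʳ : ∀ a b c x y y′ → pairing a b c x (y +K y′) ≡ pairing a b c x y +K pairing a b c x y′
  pairing-+ʳ a b c x y y′ = trans (cong (λ q → a *K (x *K (y +K y′)) +K b *K (x *K q) +K c *K (τ x *K q)) (τ-+ y y′))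
    (KS.solve 9 (λ a b c x y y′ p q q′ →
          a :* (x :* (y :+ y′)) :+ b :* (x :* (q :+ q′)) :+ c :* (p :* (q :+ q′))
          := (a :* (x :* y) :+ b :* (x :* q) :+ c :* (p :* q)) :+ (a :* (x :* y′) :+ b :* (x :* q′) :+ c :* (p :* q′)))
        refl a b c x y y′ (τ x) (τ y) (τ y′))
    where open KS

  -- Scalars are taken from ℤ because τ fixes them; over K the pairing is not linear.
  pairing-*ˡ : ∀ a b c k x y → pairing a b c (fromℤ k *K x) y ≡ fromℤ k *K pairing a b c x y
  pairing-*ˡ a b c k x y = trans (cong (λ p → a *K (fromℤ k *K x *K y) +K b *K (fromℤ k *K x *K τ y) +K c *K (p *K τ y)) (τ-fromℤ* k x))
    (KS.solve 8 (λ a b c k x y p q →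
          a :* ((k :* x) :* y) :+ b :* ((k :* x) :* q) :+ c :* ((k :* p) :* q)
          := k :* (a :* (x :* y) :+ b :* (x :* q) :+ c :* (p :* q)))
        refl a b c (fromℤ k) x y (τ x) (τ y))
    where open KS

  pairing-*ʳ : ∀ a b c k x y → pairing a b c x (fromℤ k *K y) ≡ fromℤ k *K pairing a b c x y
  pairing-*ʳ a b c k x y = trans (cong (λ q → a *K (x *K (fromℤ k *K y)) +K b *K (x *K q) +K c *K (τ x *K q)) (τ-fromℤ* k y))
    (KS.solve 8 (λ a b c k x y p q →
          a :* (x :* (k :* y)) :+ b :* (x :* (k :* q)) :+ c :* (p :* (k :* q))
          := k :* (a :* (x :* y) :+ b :* (x :* q) :+ c :* (p :* q)))
        refl a b c (fromℤ k) x y (τ x) (τ y))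
    where open KS

  -- All three terms have the same product of argument residues, since τ is invisible there, so the
  -- coefficients merge into one. The factor 8 is a 2 for the coefficient and a 2 for each argument.
  residue-pairing : ∀ {a b c x y r s t u v} → HasResidue (+ 2) a r → HasResidue (+ 2) b s → HasResidue (+ 2) c t →
    HasResidue (+ 2) x u → HasResidue (+ 2) y v → HasResidue (+ 8) (pairing a b c x y) ((r ℤ.+ s ℤ.+ t) ℤ.* (u ℤ.* v))
  residue-pairing {a} {b} {c} {x} {y} {r} {s} {t} {u} {v} ha hb hc hx hy =
    subst (HasResidue (+ 8) (pairing a b c x y)) (collect r s t (u ℤ.* v))
      (residue-+ {+ 8} {a *K (x *K y) +K b *K (x *K τ y)}
        (residue-+ {+ 8} {a *K (x *K y)} (times {a} {x} {y} ha hx hy) (times {b} {x} {τ y} hb hx hτy))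
        (times {c} {τ x} {τ y} hc (residue-τ {+ 2} {x} hx) hτy))
    where
    hτy = residue-τ {+ 2} {y} hy
    times : ∀ {a x y r u v} → HasResidue (+ 2) a r → HasResidue (+ 2) x u → HasResidue (+ 2) y v →
      HasResidue (+ 8) (a *K (x *K y)) (r ℤ.* (u ℤ.* v))
    times {a} {x} {y} ha hx hy = residue-* {+ 2} {+ 4} {a} {x *K y} ha (residue-* {+ 2} {+ 2} {x} {y} hx hy)
    collect : ∀ r s t w → r ℤ.* w ℤ.+ s ℤ.* w ℤ.+ t ℤ.* w ≡ (r ℤ.+ s ℤ.+ t) ℤ.* w
    collect = solve-∀

  residue-fromℤ⇒∣ : ∀ k z r → HasResidue k (fromℤ z) r → + D ∣ k ℤ.* z ℤ.- r
  residue-fromℤ⇒∣ k z r (p , q , e , d) = subst (λ a → + D ∣ a ℤ.- r)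
    (ι-injective {p} {k ℤ.* z} (cong proj₁ (trans (sym e) (sym (fromℤ-* k z))))) d

  -- Extending the triangular coefficients by zero lets the three parts of the form be combined into
  -- a single double sum of pairings.
  mask : ∀ {n} → (Fin n → Fin n → K) → Fin n → Fin n → K
  mask M i j with i Fin.≤? j
  ... | yes _ = M i j
  ... | no _ = 0K

  InOK-0 : InOK 0K
  InOK-0 = + 0 , + 0 , sym (cong (0K +K_) (zeroˡ ω))

  InOK-mask : ∀ {n} (M : Fin n → Fin n → K) → (∀ i j → i Fin.≤ j → InOK (M i j)) → ∀ i j → InOK (mask M i j)
  InOK-mask M h i j with i Fin.≤? j
  ... | yes i≤j = h i j i≤j
  ... | no _ = InOK-0

  -- The local function of sumTri cannot be named here, so this is proved only for the fixed n
  -- for which both sides unfold.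
  SumTriMask : ℕ → Set
  SumTriMask n = ∀ (M x : Fin n → Fin n → K) →
    sumTri (λ i j → M i j *K x i j) ≡ sumK₂ (λ i j → mask M i j *K x i j)

  sumTriMask₂ : SumTriMask 2
  sumTriMask₂ M x = cong (λ z → (m 0F 0F +K (m 0F 1F +K 0K)) +K ((z +K (m 1F 1F +K 0K)) +K 0K)) (sym (zeroˡ (x 1F 0F)))
    where
    m : Fin 2 → Fin 2 → K
    m i j = M i j *K x i j

  sumTriMask₃ : SumTriMask 3
  sumTriMask₃ M x = below-diagonal (sym (zeroˡ (x 1F 0F))) (sym (zeroˡ (x 2F 0F))) (sym (zeroˡ (x 2F 1F)))
    where
    m : Fin 3 → Fin 3 → K
    m i j = M i j *K x i j
    total : K → K → K → K
    total a b c = (m 0F 0F +K (m 0F 1F +K (m 0F 2F +K 0K)))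
      +K ((a +K (m 1F 1F +K (m 1F 2F +K 0K)))
      +K ((b +K (c +K (m 2F 2F +K 0K))) +K 0K))
    below-diagonal : ∀ {a a′ b b′ c c′} → a ≡ a′ → b ≡ b′ → c ≡ c′ → total a b c ≡ total a′ b′ c′
    below-diagonal refl refl refl = refl

  Positive⇒0< : ∀ {z} → Positive (fromℤ z) → + 0 ℤ.< z
  Positive⇒0< (inj₁ (0<a , _)) = 0<ι⇒0< 0<a
  Positive⇒0< (inj₂ (inj₁ (_ , 0<0))) = contradiction 0<0 (ℚP.<-irrefl refl)
  Positive⇒0< (inj₂ (inj₂ (inj₁ (0<a , _)))) = 0<ι⇒0< 0<a
  Positive⇒0< (inj₂ (inj₂ (inj₂ (_ , 0<0 , _)))) = contradiction 0<0 (ℚP.<-irrefl refl)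

  -- From a ℤ-universal form to a lattice

  module _ {n} (tri : SumTriMask n) (G : GQF n) (univ : ZUniversal G) where
    open GQF G
    positiveDefinite = proj₁ univ
    integral = proj₁ (proj₂ univ)
    zValued = proj₁ (proj₂ (proj₂ univ))
    universal = proj₂ (proj₂ (proj₂ univ))

    summand : (v w : Fin n → K) → Fin n → Fin n → K
    summand v w i j = pairing (mask α i j) (β i j) (mask γ i j) (v i) (w j)

    T : (v w : Fin n → K) → K
    T v w = sumK₂ (summand v w)

    eval≡T : ∀ v → eval G v ≡ T v v
    eval≡T v = sym (begin
      T v v ≡⟨ sumK₂-+ (λ i j → a i j +K b i j) c ⟩
      sumK₂ (λ i j → a i j +K b i j) +K sumK₂ c ≡⟨ cong (_+K sumK₂ c) (sumK₂-+ a b) ⟩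
      sumK₂ a +K sumK₂ b +K sumK₂ c ≡⟨ cong₂ (λ p q → p +K sumK₂ b +K q) (tri α (λ i j → v i *K v j)) (tri γ (λ i j → τ (v i) *K τ (v j))) ⟨
      eval G v ∎)
      where
      open ≡-Reasoning
      a b c : Fin n → Fin n → K
      a i j = mask α i j *K (v i *K v j)
      b i j = β i j *K (v i *K τ (v j))
      c i j = mask γ i j *K (τ (v i) *K τ (v j))

    _⊕_ : (v w : Fin n → K) → Fin n → K
    (v ⊕ w) i = v i +K w i

    _⊙_ : ℤ → (Fin n → K) → Fin n → K
    (c ⊙ v) i = fromℤ c *K v i

    T-+ˡ : ∀ u v w → T (u ⊕ v) w ≡ T u w +K T v w
    T-+ˡ u v w = trans (sumK₂-cong (λ i j → pairing-+ˡ (mask α i j) (β i j) (mask γ i j) (u i) (v i) (w j)))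
      (sumK₂-+ (summand u w) (summand v w))

    T-+ʳ : ∀ u v w → T u (v ⊕ w) ≡ T u v +K T u w
    T-+ʳ u v w = trans (sumK₂-cong (λ i j → pairing-+ʳ (mask α i j) (β i j) (mask γ i j) (u i) (v j) (w j)))
      (sumK₂-+ (summand u v) (summand u w))

    T-*ˡ : ∀ c v w → T (c ⊙ v) w ≡ fromℤ c *K T v w
    T-*ˡ c v w = trans (sumK₂-cong (λ i j → pairing-*ˡ (mask α i j) (β i j) (mask γ i j) c (v i) (w j)))
      (sumK₂-* (fromℤ c) (summand v w))

    T-*ʳ : ∀ c v w → T v (c ⊙ w) ≡ fromℤ c *K T v w
    T-*ʳ c v w = trans (sumK₂-cong (λ i j → pairing-*ʳ (mask α i j) (β i j) (mask γ i j) c (v i) (w j)))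
      (sumK₂-* (fromℤ c) (summand v w))

    T-zero : ∀ v → (∀ i → v i ≡ 0K) → T v v ≡ 0K
    T-zero v v≡0 = trans (sumK₂-cong (λ i j → cong (λ x → pairing (mask α i j) (β i j) (mask γ i j) x (v j))
        (trans (v≡0 i) (sym (zeroˡ (v i))))))
      (trans (T-*ˡ (+ 0) v v) (zeroˡ (T v v)))

    V : Set
    V = Σ (Fin n → K) (λ v → ∀ i → InOK (v i))

    F : V → ℤ
    F (v , hv) = proj₁ (zValued v hv)

    fromℤ-F : ∀ v → fromℤ (F v) ≡ T (proj₁ v) (proj₁ v)
    fromℤ-F (v , hv) = trans (sym (proj₂ (zValued v hv))) (eval≡T v)

    F-nonneg : ∀ v → + 0 ℤ.≤ F v
    -- A negative value already shows that the vector is nonzero, so positive definiteness applies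
    -- without deciding whether it vanishes.
    F-nonneg v@(v′ , hv) = ℤP.≮⇒≥ λ F<0 →
      ℤP.<-asym F<0 (Positive⇒0< (subst Positive (proj₂ (zValued v′ hv)) (positiveDefinite v′ λ v≡0 →
        ℤP.<-irrefl (fromℤ-injective (trans (fromℤ-F v) (T-zero v′ v≡0))) F<0)))

    _⊕ᵛ_ : V → V → V
    (v , hv) ⊕ᵛ (w , hw) = v ⊕ w , λ i → InOK-+ (hv i) (hw i)

    _⊙ᵛ_ : ℤ → V → V
    c ⊙ᵛ (v , hv) = c ⊙ v , λ i → InOK-* c (hv i)

    -- Polarising the integer values makes `B` integral by construction; bilinearity is then
    -- inherited from `polar`, which a priori only lies in K.
    B : V → V → ℤ
    B v w = F (v ⊕ᵛ w) ℤ.- F v ℤ.- F w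

    polar : (v w : Fin n → K) → K
    polar v w = T v w +K T w v

    fromℤ-B : ∀ v w → fromℤ (B v w) ≡ polar (proj₁ v) (proj₁ w)
    fromℤ-B v w = +K-cancelʳ (fromℤ (F v) +K fromℤ (F w)) (fromℤ (B v w)) (polar (proj₁ v) (proj₁ w)) (begin
      fromℤ (B v w) +K (fromℤ (F v) +K fromℤ (F w)) ≡⟨ cong (fromℤ (B v w) +K_) (fromℤ-+ (F v) (F w)) ⟨
      fromℤ (B v w) +K fromℤ (F v ℤ.+ F w) ≡⟨ fromℤ-+ (B v w) (F v ℤ.+ F w) ⟨
      fromℤ (B v w ℤ.+ (F v ℤ.+ F w)) ≡⟨ cong fromℤ (restore (F (v ⊕ᵛ w)) (F v) (F w)) ⟩
      fromℤ (F (v ⊕ᵛ w)) ≡⟨ fromℤ-F (v ⊕ᵛ w) ⟩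
      T (x ⊕ y) (x ⊕ y) ≡⟨ T-+ˡ x y (x ⊕ y) ⟩
      T x (x ⊕ y) +K T y (x ⊕ y) ≡⟨ cong₂ _+K_ (T-+ʳ x x y) (T-+ʳ y x y) ⟩
      (T x x +K T x y) +K (T y x +K T y y) ≡⟨ KS.solve 4 (λ a b c d → (a KS.:+ b) KS.:+ (c KS.:+ d) KS.:= (b KS.:+ c) KS.:+ (a KS.:+ d)) refl (T x x) (T x y) (T y x) (T y y) ⟩
      polar x y +K (T x x +K T y y) ≡⟨ cong₂ (λ a b → polar x y +K (a +K b)) (fromℤ-F v) (fromℤ-F w) ⟨
      polar x y +K (fromℤ (F v) +K fromℤ (F w)) ∎)
      where
      open ≡-Reasoning
      open import Algebra.Properties.Ring (CommutativeRing.ring K-commutativeRing) using () renaming (+-cancelʳ to +K-cancelʳ)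
      x = proj₁ v
      y = proj₁ w
      restore : ∀ a b c → a ℤ.- b ℤ.- c ℤ.+ (b ℤ.+ c) ≡ a
      restore = solve-∀

    residueOf : V → Fin n → ℤ
    residueOf (v , hv) i = proj₁ (InOK⇒residue (hv i))

    InOK-α = InOK-mask α (proj₁ integral)
    InOK-β = proj₁ (proj₂ integral)
    InOK-γ = InOK-mask γ (proj₂ (proj₂ integral))

    S : Fin n → Fin n → ℤ
    S i j = proj₁ (InOK⇒residue (InOK-α i j)) ℤ.+ proj₁ (InOK⇒residue (InOK-β i j)) ℤ.+ proj₁ (InOK⇒residue (InOK-γ i j))

    residue-T : ∀ v w → HasResidue (+ 8) (T (proj₁ v) (proj₁ w))
      (sum (λ i → sum (λ j → S i j ℤ.* (residueOf v i ℤ.* residueOf w j))))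
    residue-T V@(v , hv) W@(w , hw) =
      residue-sum (+ 8) (λ i → sumK (summand v w i)) (λ i → sum (λ j → S i j ℤ.* (residueOf V i ℤ.* residueOf W j))) λ i →
      residue-sum (+ 8) (summand v w i) (λ j → S i j ℤ.* (residueOf V i ℤ.* residueOf W j)) λ j →
      residue-pairing {mask α i j} {β i j} {mask γ i j} {v i} {w j}
        (proj₂ (InOK⇒residue (InOK-α i j))) (proj₂ (InOK⇒residue (InOK-β i j))) (proj₂ (InOK⇒residue (InOK-γ i j)))
        (proj₂ (InOK⇒residue (hv i))) (proj₂ (InOK⇒residue (hw j)))

    residue-B : ∀ v w → + D ∣ + 8 ℤ.* B v w ℤ.- sum (λ i → residueOf v i ℤ.* sum (λ j → (S i j ℤ.+ S j i) ℤ.* residueOf w j))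
    residue-B v w = residue-fromℤ⇒∣ (+ 8) (B v w) (sum (λ i → residueOf v i ℤ.* sum (λ j → (S i j ℤ.+ S j i) ℤ.* residueOf w j)))
      (subst₂ (HasResidue (+ 8)) (sym (fromℤ-B v w)) (symmetrize S (residueOf v) (residueOf w))
        (residue-+ {+ 8} {T (proj₁ v) (proj₁ w)} {T (proj₁ w) (proj₁ v)} (residue-T v w) (residue-T w v)))

    lattice : Lattice D n
    lattice = record
      { V = V
      ; _⊕_ = _⊕ᵛ_
      ; _⊙_ = _⊙ᵛ_
      ; B = B
      ; B-sym = λ v w → fromℤ-injective (trans (fromℤ-B v w)
          (trans (CommutativeRing.+-comm K-commutativeRing (T (proj₁ v) (proj₁ w)) (T (proj₁ w) (proj₁ v))) (sym (fromℤ-B w v))))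
      ; B-⊕ = B-⊕
      ; B-⊙ = B-⊙
      ; B-nonneg = λ v → subst (+ 0 ℤ.≤_) (sym (B-diag v)) (ℤP.*-monoˡ-≤-nonNeg (+ 2) (F-nonneg v))
      ; B-universal = λ m 1≤m → let (a , ha , e) = universal m 1≤m in (a , ha) ,
          trans (B-diag (a , ha)) (cong (+ 2 ℤ.*_) (fromℤ-injective {F (a , ha)} {+ m} (trans (sym (proj₂ (zValued a ha))) e)))
      ; φ = residueOf
      ; ψ = λ w i → sum (λ j → (S i j ℤ.+ S j i) ℤ.* residueOf w j)
      ; B-residue = residue-B }
      where
      B-⊕ : ∀ u v w → B (u ⊕ᵛ v) w ≡ B u w ℤ.+ B v w
      B-⊕ u v w = fromℤ-injective (begin
        fromℤ (B (u ⊕ᵛ v) w) ≡⟨ fromℤ-B (u ⊕ᵛ v) w ⟩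
        T (x ⊕ y) z +K T z (x ⊕ y) ≡⟨ cong₂ _+K_ (T-+ˡ x y z) (T-+ʳ z x y) ⟩
        (T x z +K T y z) +K (T z x +K T z y) ≡⟨ KS.solve 4 (λ a b c d → (a KS.:+ b) KS.:+ (c KS.:+ d) KS.:= (a KS.:+ c) KS.:+ (b KS.:+ d)) refl (T x z) (T y z) (T z x) (T z y) ⟩
        polar x z +K polar y z ≡⟨ cong₂ _+K_ (fromℤ-B u w) (fromℤ-B v w) ⟨
        fromℤ (B u w) +K fromℤ (B v w) ≡⟨ fromℤ-+ (B u w) (B v w) ⟨
        fromℤ (B u w ℤ.+ B v w) ∎)
        where
        open ≡-Reasoning
        x = proj₁ u
        y = proj₁ v
        z = proj₁ w
      B-⊙ : ∀ c v w → B (c ⊙ᵛ v) w ≡ c ℤ.* B v w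
      B-⊙ c v w = fromℤ-injective (begin
        fromℤ (B (c ⊙ᵛ v) w) ≡⟨ fromℤ-B (c ⊙ᵛ v) w ⟩
        T (c ⊙ x) y +K T y (c ⊙ x) ≡⟨ cong₂ _+K_ (T-*ˡ c x y) (T-*ʳ c y x) ⟩
        fromℤ c *K T x y +K fromℤ c *K T y x ≡⟨ distribˡ (fromℤ c) (T x y) (T y x) ⟨
        fromℤ c *K polar x y ≡⟨ cong (fromℤ c *K_) (fromℤ-B v w) ⟨
        fromℤ c *K fromℤ (B v w) ≡⟨ fromℤ-* c (B v w) ⟨
        fromℤ (c ℤ.* B v w) ∎)
        where
        open ≡-Reasoning
        x = proj₁ v
        y = proj₁ w
      B-diag : ∀ v → B v v ≡ + 2 ℤ.* F v
      B-diag v = fromℤ-injective (begin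
        fromℤ (B v v) ≡⟨ fromℤ-B v v ⟩
        T x x +K T x x ≡⟨ cong₂ _+K_ (fromℤ-F v) (fromℤ-F v) ⟨
        fromℤ (F v) +K fromℤ (F v) ≡⟨ fromℤ-+ (F v) (F v) ⟨
        fromℤ (F v ℤ.+ F v) ≡⟨ cong fromℤ (double (F v)) ⟩
        fromℤ (+ 2 ℤ.* F v) ∎)
        where
        open ≡-Reasoning
        x = proj₁ v
        double : ∀ a → a ℤ.+ a ≡ + 2 ℤ.* a
        double = solve-∀

-- The finite search for numbers that a span misses

module Representation where
  open import Data.Bool using (Bool; if_then_else_; _∧_; _∨_; not; T)
  open import Data.Bool.ListAction using (any)
  open import Data.Bool.Properties using (T-∧; T-∨)
  open import Data.List using (List; []; _∷_; foldl)
  open import Data.List.Relation.Unary.Any using (satisfied)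
  open import Data.List.Relation.Unary.Any.Properties using (any⁻)
  open import Data.Nat
  open import Data.Nat.DivMod using (m*n%n≡0; m*n/n≡m)
  open import Data.Nat.Properties
  open import Function.Bundles using (Equivalence)

  allBelow : ℕ → (ℕ → Bool) → Bool
  allBelow zero p = true
  allBelow (suc n) p = p n ∧ allBelow n p

  allBelow-sound : ∀ n p → T (allBelow n p) → ∀ {k} → k < n → T (p k)
  allBelow-sound (suc n) p h k<1+n with Equivalence.to T-∧ h | m≤n⇒m<n∨m≡n (s≤s⁻¹ k<1+n)
  ... | _ , h′ | inj₁ k<n = allBelow-sound n p h′ k<n
  ... | h′ , _ | inj₂ refl = h′

  -- No property of isqrt is needed, since nonSquareᵇ tests its value; it is opaque
  -- because it unfolds to a huge term on open arguments.
  opaque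
    isqrt : ℕ → ℕ
    isqrt n = foldl (λ k b → if (k + b) * (k + b) ≤ᵇ n then k + b else k) 0
      (256 ∷ 128 ∷ 64 ∷ 32 ∷ 16 ∷ 8 ∷ 4 ∷ 2 ∷ 1 ∷ [])

  between : ℕ → ℕ → Bool
  between n k = (k * k <ᵇ n) ∧ (n <ᵇ suc k * suc k)

  nonSquareᵇ : ℕ → Bool
  nonSquareᵇ n = between n (isqrt n)

  m*m<n*n⇒m<n : ∀ m n → m * m < n * n → m < n
  m*m<n*n⇒m<n m n p with m <? n
  ... | yes m<n = m<n
  ... | no m≮n = contradiction p (≤⇒≯ (*-mono-≤ (≮⇒≥ m≮n) (≮⇒≥ m≮n)))

  between-sound : ∀ n k → T (between n k) → ∀ z → z * z ≢ n
  between-sound n k h z refl with Equivalence.to (T-∧ {k * k <ᵇ n}) h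
  ... | k²<z² , z²<[1+k]² = <⇒≱ (m*m<n*n⇒m<n k z (<ᵇ⇒< _ _ k²<z²))
    (s≤s⁻¹ (m*m<n*n⇒m<n z (suc k) (<ᵇ⇒< _ _ z²<[1+k]²)))

  nonSquareᵇ-sound : ∀ n → T (nonSquareᵇ n) → ∀ z → z * z ≢ n
  nonSquareᵇ-sound n = between-sound n (isqrt n)

  -- A difference that would be truncated passes vacuously, so that no spurious value 0 is tested.
  onDifferences : ℕ → (ℕ → ℕ) → (ℕ → Bool) → ℕ → Bool
  onDifferences a f p n = allBelow a λ x → (n <ᵇ f x) ∨ p (n ∸ f x)

  onDifferences-sound : ∀ a f p {n} → T (onDifferences a f p n) → ∀ {x w} → x < a → f x + w ≡ n → T (p w)
  onDifferences-sound a f p h {x} {w} x<a refl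
    with Equivalence.to (T-∨ {f x + w <ᵇ f x}) (allBelow-sound a (λ x′ → (f x + w <ᵇ f x′) ∨ p (f x + w ∸ f x′)) h x<a)
  ... | inj₁ n<m = contradiction (<ᵇ⇒< (f x + w) (f x) n<m) (≤⇒≯ (m≤m+n (f x) w))
  ... | inj₂ h′ = subst (λ k → T (p k)) (m+n∸m≡n (f x) w) h′

  onRemainders : (a b s : ℕ) → (ℕ → Bool) → ℕ → Bool
  onRemainders a b s p = onDifferences a (λ x → s * (x * x)) (onDifferences b (λ y → y * y) p)

  -- Found by a search: for each (s , M) that occurs, a vector of one of these norms is independent
  -- of the first three vectors.
  candidates : List ℕ
  candidates = 5 ∷ 6 ∷ 7 ∷ 10 ∷ 13 ∷ 14 ∷ 17 ∷ 21 ∷ 22 ∷ 29 ∷ 38 ∷ 93 ∷ 115 ∷ []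

  -- The ranges suffice for s ≤ 8 and t ≤ 115, because 22² = 484 > 4 · 115 and 61² = 3721 > 4 · 8 ·
  -- 115.
  missedᵇ : (s M t : ℕ) → Bool
  missedᵇ s M t = onRemainders 22 61 s (λ w → nonSquareᵇ (M * w)) (4 * s * t)

  missesOneᵇ : ℕ → ℕ → Bool
  missesOneᵇ s M = (0 <ᵇ M) ∧ any (λ t → (0 <ᵇ t) ∧ (t ≤ᵇ 115) ∧ missedᵇ s M t) candidates

  -- Here s ≤ 8 and t ≤ 5, with 5² > 4 · 5 and 13² > 4 · 8 · 5. The remainder is 4 M for the
  -- third-stage parameter M, so remainders that 4 does not divide are skipped.
  escalatesᵇ : (s t : ℕ) → Bool
  escalatesᵇ s t = onRemainders 5 13 s (λ r → not (r % 4 ≡ᵇ 0) ∨ missesOneᵇ s (r / 4)) (4 * s * t)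

  -- Here x, y, z stand for the products of a vector v of norm t with the orthogonalised first three
  -- vectors, and z² = M w says that v is dependent on them.
  MissesOne : ℕ → ℕ → Set
  MissesOne s M = 1 ≤ M × ∃[ t ] 1 ≤ t × t ≤ 115 ×
    (∀ x y z w → s * (x * x) + (y * y + w) ≡ 4 * s * t → z * z ≢ M * w)

  Escalates : ℕ → ℕ → Set
  Escalates s t = ∀ c d M → s * (c * c) + (d * d + M * 4) ≡ 4 * s * t → MissesOne s M

  -- No solution escapes the ranges: the equation forces x² ≤ 4 t and y² ≤ 4 s t.
  onRemainders-sound : ∀ a b {s} .{{_ : NonZero s}} p t → 4 * t < a * a → 4 * s * t < b * b →
    T (onRemainders a b s p (4 * s * t)) → ∀ x y w → s * (x * x) + (y * y + w) ≡ 4 * s * t → T (p w)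
  onRemainders-sound a b {s} p t 4t<a² 4st<b² h x y w e =
    onDifferences-sound b (λ y → y * y) p
      (onDifferences-sound a (λ x → s * (x * x)) (onDifferences b (λ y → y * y) p) h x<a e) y<b refl
    where
    open ≤-Reasoning
    x<a : x < a
    x<a = m*m<n*n⇒m<n x a (≤-<-trans (*-cancelˡ-≤ s (begin
      s * (x * x)               ≤⟨ m≤m+n _ (y * y + w) ⟩
      s * (x * x) + (y * y + w) ≡⟨ e ⟩
      4 * s * t                 ≡⟨ cong (_* t) (*-comm 4 s) ⟩
      s * 4 * t                 ≡⟨ *-assoc s 4 t ⟩
      s * (4 * t)               ∎)) 4t<a²)
    y<b : y < b
    y<b = m*m<n*n⇒m<n y b (≤-<-trans (begin
      y * y                     ≤⟨ m≤m+n _ w ⟩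
      y * y + w                 ≤⟨ m≤n+m _ (s * (x * x)) ⟩
      s * (x * x) + (y * y + w) ≡⟨ e ⟩
      4 * s * t                 ∎) 4st<b²)

  missedᵇ-sound : ∀ {s} .{{_ : NonZero s}} M {t} → s ≤ 8 → t ≤ 115 → T (missedᵇ s M t) →
    ∀ x y z w → s * (x * x) + (y * y + w) ≡ 4 * s * t → z * z ≢ M * w
  missedᵇ-sound M {t} s≤8 t≤115 h x y z w e = nonSquareᵇ-sound (M * w)
    (onRemainders-sound 22 61 (λ w → nonSquareᵇ (M * w)) t
      (<-≤-trans (s≤s (*-monoʳ-≤ 4 t≤115)) (≤ᵇ⇒≤ 461 484 tt))
      (<-≤-trans (s≤s (*-mono-≤ (*-monoʳ-≤ 4 s≤8) t≤115)) (≤ᵇ⇒≤ 3681 3721 tt)) h x y w e) z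

  missesOneᵇ-sound : ∀ {s} .{{_ : NonZero s}} M → s ≤ 8 → T (missesOneᵇ s M) → MissesOne s M
  missesOneᵇ-sound {s} M s≤8 h =
    let 0<M , h₁ = Equivalence.to (T-∧ {0 <ᵇ M}) h
        t , h₂ = satisfied (any⁻ (λ t → (0 <ᵇ t) ∧ (t ≤ᵇ 115) ∧ missedᵇ s M t) candidates h₁)
        0<t , h₃ = Equivalence.to (T-∧ {0 <ᵇ t}) h₂
        t≤ᵇ115 , h₄ = Equivalence.to (T-∧ {t ≤ᵇ 115} {missedᵇ s M t}) h₃
        t≤115 = ≤ᵇ⇒≤ t 115 t≤ᵇ115
    in <ᵇ⇒< 0 M 0<M , t , <ᵇ⇒< 0 t 0<t , t≤115 , missedᵇ-sound M s≤8 t≤115 h₄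

  escalatesᵇ-sound : ∀ {s} .{{_ : NonZero s}} t → s ≤ 8 → 4 * t < 25 → 4 * s * t < 169 →
    T (escalatesᵇ s t) → Escalates s t
  escalatesᵇ-sound {s} t s≤8 4t<25 4st<169 h c d M e =
    missesOneᵇ-sound M s≤8 (subst (λ k → T (missesOneᵇ s k)) (m*n/n≡m M 4) (divisible
      (onRemainders-sound 5 13 (λ r → not (r % 4 ≡ᵇ 0) ∨ missesOneᵇ s (r / 4)) t 4t<25 4st<169 h c d (M * 4) e)))
    where
    divisible : ∀ {p} → T (not (M * 4 % 4 ≡ᵇ 0) ∨ p) → T p
    divisible {p} = subst (λ k → T (not (k ≡ᵇ 0) ∨ p) → T p) (sym (m*n%n≡0 M 4)) (λ h → h)

  opaque
    -- Only closed numerals occur in the checks below, so here the square root may compute and each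
    -- check reduces to `tt`.
    unfolding isqrt

    -- In each of the three cases t is a prime inert in ℚ(√-s), hence not a norm from that field;
    -- this excludes M = 0. It is also the least positive integer that the binary form misses.
    escalates-4-3 : Escalates 4 3
    escalates-4-3 = escalatesᵇ-sound 3 (≤ᵇ⇒≤ 4 8 tt) (≤ᵇ⇒≤ 13 25 tt) (≤ᵇ⇒≤ 49 169 tt) tt

    escalates-7-3 : Escalates 7 3
    escalates-7-3 = escalatesᵇ-sound 3 (≤ᵇ⇒≤ 7 8 tt) (≤ᵇ⇒≤ 13 25 tt) (≤ᵇ⇒≤ 85 169 tt) tt

    escalates-8-5 : Escalates 8 5
    escalates-8-5 = escalatesᵇ-sound 5 ≤-refl (≤ᵇ⇒≤ 21 25 tt) (≤ᵇ⇒≤ 161 169 tt) tt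

module Escalation where
  open import Data.Integer using (-_; _+_; _*_; _-_; ∣_∣; -[1+_])
  open import Data.Nat using (zero; suc)
  open Representation using (Escalates; escalates-4-3; escalates-7-3; escalates-8-5)

  -- Determinants and rank modulo D

  det : (Fin 3 → ℤ) → (Fin 3 → ℤ) → (Fin 3 → ℤ) → ℤ
  det x y z = x 0F * (y 1F * z 2F - y 2F * z 1F)
            - x 1F * (y 0F * z 2F - y 2F * z 0F)
            + x 2F * (y 0F * z 1F - y 1F * z 0F)

  infix 8 _·_
  _·_ : (Fin 3 → ℤ) → (Fin 3 → ℤ) → ℤ
  x · y = sum (λ i → x i * y i)

  -- Multiplicativity of the determinant, applied to the matrix of dot products. The trailing `+ 0`
  -- in the identity is the empty tail of `sum`.
  det-product : ∀ x y z a b c → det x y z * det a b c ≡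
    (x · a) * ((y · b) * (z · c) - (y · c) * (z · b))
    - (x · b) * ((y · a) * (z · c) - (y · c) * (z · a))
    + (x · c) * ((y · a) * (z · b) - (y · b) * (z · a))
  det-product x y z a b c = identity (x 0F) (x 1F) (x 2F) (y 0F) (y 1F) (y 2F)
    (z 0F) (z 1F) (z 2F) (a 0F) (a 1F) (a 2F)
    (b 0F) (b 1F) (b 2F) (c 0F) (c 1F) (c 2F)
    where
    identity : ∀ x1 x2 x3 y1 y2 y3 z1 z2 z3 a1 a2 a3 b1 b2 b3 c1 c2 c3 →
     (x1 * (y2 * z3 - y3 * z2) - x2 * (y1 * z3 - y3 * z1) + x3 * (y1 * z2 - y2 * z1))
     * (a1 * (b2 * c3 - b3 * c2) - a2 * (b1 * c3 - b3 * c1) + a3 * (b1 * c2 - b2 * c1))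
     ≡ (x1 * a1 + (x2 * a2 + (x3 * a3 + + 0)))
       * ((y1 * b1 + (y2 * b2 + (y3 * b3 + + 0))) * (z1 * c1 + (z2 * c2 + (z3 * c3 + + 0)))
         - (y1 * c1 + (y2 * c2 + (y3 * c3 + + 0))) * (z1 * b1 + (z2 * b2 + (z3 * b3 + + 0))))
     - (x1 * b1 + (x2 * b2 + (x3 * b3 + + 0)))
       * ((y1 * a1 + (y2 * a2 + (y3 * a3 + + 0))) * (z1 * c1 + (z2 * c2 + (z3 * c3 + + 0)))
         - (y1 * c1 + (y2 * c2 + (y3 * c3 + + 0))) * (z1 * a1 + (z2 * a2 + (z3 * a3 + + 0))))
     + (x1 * c1 + (x2 * c2 + (x3 * c3 + + 0)))
       * ((y1 * a1 + (y2 * a2 + (y3 * a3 + + 0))) * (z1 * b1 + (z2 * b2 + (z3 * b3 + + 0)))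
         - (y1 * b1 + (y2 * b2 + (y3 * b3 + + 0))) * (z1 * a1 + (z2 * a2 + (z3 * a3 + + 0))))
    identity = solve-∀

  -- Cramer's rule for the linear relation among four vectors in dimension three, paired with `v`.
  cramer : ∀ x y z w v → det x y z * (w · v) ≡ det w y z * (x · v) + det x w z * (y · v) + det x y w * (z · v)
  cramer x y z w v = identity (x 0F) (x 1F) (x 2F) (y 0F) (y 1F) (y 2F)
    (z 0F) (z 1F) (z 2F) (w 0F) (w 1F) (w 2F)
    (v 0F) (v 1F) (v 2F)
    where
    identity : ∀ x1 x2 x3 y1 y2 y3 z1 z2 z3 w1 w2 w3 v1 v2 v3 →
     (x1 * (y2 * z3 - y3 * z2) - x2 * (y1 * z3 - y3 * z1) + x3 * (y1 * z2 - y2 * z1)) * (w1 * v1 + (w2 * v2 + (w3 * v3 + + 0)))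
     ≡ (w1 * (y2 * z3 - y3 * z2) - w2 * (y1 * z3 - y3 * z1) + w3 * (y1 * z2 - y2 * z1)) * (x1 * v1 + (x2 * v2 + (x3 * v3 + + 0)))
     + (x1 * (w2 * z3 - w3 * z2) - x2 * (w1 * z3 - w3 * z1) + x3 * (w1 * z2 - w2 * z1)) * (y1 * v1 + (y2 * v2 + (y3 * v3 + + 0)))
     + (x1 * (y2 * w3 - y3 * w2) - x2 * (y1 * w3 - y3 * w1) + x3 * (y1 * w2 - y2 * w1)) * (z1 * v1 + (z2 * v2 + (z3 * v3 + + 0)))
    identity = solve-∀

  -- The 4 × 4 matrix of products has rank at most 3, so its determinant vanishes, while modulo d it
  -- is diagonal. To avoid expanding that determinant, the first three diagonal entries are replaced
  -- modulo d by `detX * detY`, and `cramer` writes `detX` times the fourth through off-diagonal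
  -- entries.
  ∣-product-off-diagonal : ∀ {d} (x y : Fin 4 → Fin 3 → ℤ) → (∀ i j → i ≢ j → d ∣ x i · y j) →
    let e = λ i → x i · y i in d ∣ e 0F * e 1F * e 2F * e 3F
  ∣-product-off-diagonal {d} x y off = subst (d ∣_)
    (sym (expand (e 0F 0F) (e 1F 1F) (e 2F 2F) (e 3F 3F) (e 1F 2F * e 2F 1F) (e 0F 1F) (e 0F 2F)
      (e 1F 0F * e 2F 2F - e 1F 2F * e 2F 0F) (e 1F 0F * e 2F 1F - e 1F 1F * e 2F 0F)
      detX detY (det-product (x 0F) (x 1F) (x 2F) (y 0F) (y 1F) (y 2F))))
    (∣m∣n⇒∣m+n (∣n⇒∣m*n detY d∣detX*e₃₃) (∣m⇒∣m*n (e 3F 3F) (∣m∣n⇒∣m-n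
      (∣m∣n⇒∣m+n (∣n⇒∣m*n (e 0F 0F) (∣m⇒∣m*n (e 2F 1F) (off 1F 2F λ ())))
        (∣m⇒∣m*n _ (off 0F 1F λ ()))) (∣m⇒∣m*n _ (off 0F 2F λ ())))))
    where
    e : Fin 4 → Fin 4 → ℤ
    e i j = x i · y j
    detX detY : ℤ
    detX = det (x 0F) (x 1F) (x 2F)
    detY = det (y 0F) (y 1F) (y 2F)
    d∣detX*e₃₃ : d ∣ detX * e 3F 3F
    d∣detX*e₃₃ = subst (d ∣_) (sym (cramer (x 0F) (x 1F) (x 2F) (x 3F) (y 3F)))
      (∣m∣n⇒∣m+n (∣m∣n⇒∣m+n (∣n⇒∣m*n (det (x 3F) (x 1F) (x 2F)) (off 0F 3F λ ()))
          (∣n⇒∣m*n (det (x 0F) (x 3F) (x 2F)) (off 1F 3F λ ())))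
        (∣n⇒∣m*n (det (x 0F) (x 1F) (x 3F)) (off 2F 3F λ ())))
    rearrange : ∀ a b c f o p q u v → a * b * c * f
      ≡ (a * (b * c - o) - p * u + q * v) * f + (a * o + p * u - q * v) * f
    rearrange = solve-∀
    reassociate : ∀ X Y f g → X * Y * f + g ≡ Y * (X * f) + g
    reassociate = solve-∀
    expand : ∀ a b c f o p q u v X Y → X * Y ≡ a * (b * c - o) - p * u + q * v →
      a * b * c * f ≡ Y * (X * f) + (a * o + p * u - q * v) * f
    expand a b c f o p q u v X Y h = trans (rearrange a b c f o p q u v)
      (trans (cong (λ k → k * f + (a * o + p * u - q * v) * f) (sym h)) (reassociate X Y f _))

  ∣-*-cong : ∀ {d} a b a′ b′ → d ∣ a - b → d ∣ a′ - b′ → d ∣ a * a′ - b * b′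
  ∣-*-cong {d} a b a′ b′ p q = subst (d ∣_) (sym (split a b a′ b′)) (∣m∣n⇒∣m+n (∣n⇒∣m*n a q) (∣m⇒∣m*n b′ p))
    where
    split : ∀ a b a′ b′ → a * a′ - b * b′ ≡ a * (a′ - b′) + (a - b) * b′
    split = solve-∀

  i*i≡+∣i∣*∣i∣ : ∀ i → i * i ≡ + (∣ i ∣ ℕ.* ∣ i ∣)
  i*i≡+∣i∣*∣i∣ (+ n) = sym (ℤP.pos-* n n)
  i*i≡+∣i∣*∣i∣ -[1+ n ] = refl

  -- For σ = 8 - b², minus the discriminant of x² + b x y + 2 y²; t is not represented by this form.
  Escalation₂ : ℤ → Set
  Escalation₂ σ = ∃[ s ] ∃[ t ] + s ≡ σ × 1 ℕ.≤ s × s ℕ.≤ 8 × 1 ℕ.≤ t × t ℕ.≤ 5 × Escalates s t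

  -- Nonnegativity gives b² ≤ 8, so |b| ≤ 2 and σ is 8, 7 or 4. As 8 is not a square, vectors of
  -- norms 1 and 2 are automatically independent.
  escalation₂ : ∀ b → + 0 ℤ.≤ + 2 * (+ 8 - b * b) → Escalation₂ (+ 8 - b * b)
  escalation₂ b 0≤ = classify ∣ b ∣ (i*i≡+∣i∣*∣i∣ b)
    where
    ∣b∣²≤8 : ∣ b ∣ ℕ.* ∣ b ∣ ℕ.≤ 8
    ∣b∣²≤8 = ℤP.drop‿+≤+ (subst (ℤ._≤ + 8) (i*i≡+∣i∣*∣i∣ b)
      (ℤP.0≤i-j⇒j≤i (ℤP.*-cancelˡ-≤-pos (+ 0) (+ 8 - b * b) (+ 2) 0≤)))
    classify : ∀ n → b * b ≡ + (n ℕ.* n) → Escalation₂ (+ 8 - b * b)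
    classify 0 e = 8 , 5 , cong (λ k → + 8 - k) (sym e) ,
      ℕP.≤ᵇ⇒≤ 1 8 tt , ℕP.≤-refl , ℕP.≤ᵇ⇒≤ 1 5 tt , ℕP.≤-refl , escalates-8-5
    classify 1 e = 7 , 3 , cong (λ k → + 8 - k) (sym e) ,
      ℕP.≤ᵇ⇒≤ 1 7 tt , ℕP.≤ᵇ⇒≤ 7 8 tt , ℕP.≤ᵇ⇒≤ 1 3 tt , ℕP.≤ᵇ⇒≤ 3 5 tt , escalates-7-3
    classify 2 e = 4 , 3 , cong (λ k → + 8 - k) (sym e) ,
      ℕP.≤ᵇ⇒≤ 1 4 tt , ℕP.≤ᵇ⇒≤ 4 8 tt , ℕP.≤ᵇ⇒≤ 1 3 tt , ℕP.≤ᵇ⇒≤ 3 5 tt , escalates-4-3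
    classify (suc (suc (suc n))) e = contradiction
      (ℕP.≤-trans (ℕP.*-mono-≤ (ℕP.m≤m+n 3 n) (ℕP.m≤m+n 3 n))
        (subst (ℕ._≤ 8) (ℤP.+-injective (trans (sym (i*i≡+∣i∣*∣i∣ b)) e)) ∣b∣²≤8))
      (ℕP.<⇒≱ (ℕP.≤ᵇ⇒≤ 9 9 tt))

  -- The search runs over naturals; signs may be dropped because c and d enter only through their
  -- squares.
  scaled-square-sum : ∀ {s t W} {σ c d w : ℤ} → + s ≡ σ → + W ≡ w →
    σ * (c * c) + (d * d + w) ≡ + 4 * σ * + t →
    s ℕ.* (∣ c ∣ ℕ.* ∣ c ∣) ℕ.+ (∣ d ∣ ℕ.* ∣ d ∣ ℕ.+ W) ≡ 4 ℕ.* s ℕ.* t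
  scaled-square-sum {s} {t} {W} {σ} {c} {d} {w} refl refl h = ℤP.+-injective (begin
    + (s ℕ.* (∣ c ∣ ℕ.* ∣ c ∣)) + (+ (∣ d ∣ ℕ.* ∣ d ∣) + + W) ≡⟨ cong (λ k → k + (+ (∣ d ∣ ℕ.* ∣ d ∣) + + W)) (ℤP.pos-* s (∣ c ∣ ℕ.* ∣ c ∣)) ⟩
    + s * + (∣ c ∣ ℕ.* ∣ c ∣) + (+ (∣ d ∣ ℕ.* ∣ d ∣) + + W)   ≡⟨ cong₂ (λ p q → + s * p + (q + + W)) (i*i≡+∣i∣*∣i∣ c) (i*i≡+∣i∣*∣i∣ d) ⟨
    + s * (c * c) + (d * d + + W)                             ≡⟨ h ⟩
    + 4 * + s * + t                                           ≡⟨ cong (_* + t) (ℤP.pos-* 4 s) ⟨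
    + (4 ℕ.* s) * + t                                         ≡⟨ ℤP.pos-* (4 ℕ.* s) t ⟨
    + (4 ℕ.* s ℕ.* t)                                         ∎)
    where open ≡-Reasoning

  0≤⇒+ : ∀ {i} → + 0 ℤ.≤ i → ∃[ n ] + n ≡ i
  0≤⇒+ {i} 0≤i = ∣ i ∣ , ℤP.0≤i⇒+∣i∣≡i 0≤i

  0≤-cancel : ∀ {k i} → 1 ℕ.≤ k → + 0 ℤ.≤ + k * i → + 0 ℤ.≤ i
  0≤-cancel {suc k} {i} _ 0≤ki = ℤP.*-cancelˡ-≤-pos (+ 0) i (+ suc k) (subst (ℤ._≤ + suc k * i) (sym (ℤP.*-zeroʳ (+ suc k))) 0≤ki)

  -- 8⁴ times the Gram determinant of the orthogonal vectors v₁, u₂, u₃, u₄ below.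
  discriminant : (s M r : ℕ) → ℕ
  discriminant s M r = 16 ℕ.* (8 ℕ.* (2 ℕ.* s)) ℕ.* (8 ℕ.* (2 ℕ.* s ℕ.* M)) ℕ.* (8 ℕ.* (2 ℕ.* s ℕ.* M ℕ.* r))

  discriminant-mono : ∀ {s s′ M M′ r r′} → s ℕ.≤ s′ → M ℕ.≤ M′ → r ℕ.≤ r′ → discriminant s M r ℕ.≤ discriminant s′ M′ r′
  discriminant-mono {s} {s′} {M} {M′} s≤ M≤ r≤ =
    ℕP.*-mono-≤ (ℕP.*-mono-≤ (ℕP.*-monoʳ-≤ 16 (ℕP.*-monoʳ-≤ 8 2s≤)) (ℕP.*-monoʳ-≤ 8 2sM≤)) (ℕP.*-monoʳ-≤ 8 (ℕP.*-mono-≤ 2sM≤ r≤))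
    where
    2s≤ : 2 ℕ.* s ℕ.≤ 2 ℕ.* s′
    2s≤ = ℕP.*-monoʳ-≤ 2 s≤
    2sM≤ : 2 ℕ.* s ℕ.* M ℕ.≤ 2 ℕ.* s′ ℕ.* M′
    2sM≤ = ℕP.*-mono-≤ 2s≤ M≤

  pos-discriminant : ∀ s M r → + discriminant s M r ≡
    + 8 * + 2 * (+ 8 * (+ 2 * + s)) * (+ 8 * (+ 2 * + s * + M)) * (+ 8 * (+ 2 * + s * + M * + r))
  pos-discriminant s M r = begin
    + (16 ℕ.* (8 ℕ.* (2 ℕ.* s)) ℕ.* (8 ℕ.* (2 ℕ.* s ℕ.* M)) ℕ.* (8 ℕ.* (2 ℕ.* s ℕ.* M ℕ.* r))) ≡⟨ ℤP.pos-* (16 ℕ.* (8 ℕ.* (2 ℕ.* s)) ℕ.* (8 ℕ.* (2 ℕ.* s ℕ.* M))) _ ⟩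
    + (16 ℕ.* (8 ℕ.* (2 ℕ.* s)) ℕ.* (8 ℕ.* (2 ℕ.* s ℕ.* M))) * + (8 ℕ.* (2 ℕ.* s ℕ.* M ℕ.* r)) ≡⟨ cong₂ _*_
      (trans (ℤP.pos-* (16 ℕ.* (8 ℕ.* (2 ℕ.* s))) _) (cong₂ _*_ (trans (ℤP.pos-* 16 (8 ℕ.* (2 ℕ.* s))) (cong (+ 16 *_) (trans (ℤP.pos-* 8 (2 ℕ.* s)) (cong (+ 8 *_) 2s)))) (trans (ℤP.pos-* 8 (2 ℕ.* s ℕ.* M)) (cong (+ 8 *_) 2sM))))
      (trans (ℤP.pos-* 8 (2 ℕ.* s ℕ.* M ℕ.* r)) (cong (+ 8 *_) (trans (ℤP.pos-* (2 ℕ.* s ℕ.* M) r) (cong (_* + r) 2sM)))) ⟩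
    + 8 * + 2 * (+ 8 * (+ 2 * + s)) * (+ 8 * (+ 2 * + s * + M)) * (+ 8 * (+ 2 * + s * + M * + r)) ∎
    where
    open ≡-Reasoning
    2s : + (2 ℕ.* s) ≡ + 2 * + s
    2s = ℤP.pos-* 2 s
    2sM : + (2 ℕ.* s ℕ.* M) ≡ + 2 * + s * + M
    2sM = trans (ℤP.pos-* (2 ℕ.* s) M) (cong (_* + M) 2s)

  module _ {D} (L : Lattice D 3) where
    open Lattice L

    -- Orthogonality makes D divide the off-diagonal products of `φ` and `ψ`, so the rank argument
    -- applies to these, and its conclusion passes to the congruent numbers 8 B(uᵢ, uᵢ).
    orthogonal⇒∣ : ∀ (u : Fin 4 → V) → (∀ i j → i Fin.< j → B (u j) (u i) ≡ + 0) →
      let g = λ i → + 8 * B (u i) (u i) in + D ∣ g 0F * g 1F * g 2F * g 3F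
    orthogonal⇒∣ u orth = subst (+ D ∣_) (cancel (g 0F * g 1F * g 2F * g 3F) (e 0F * e 1F * e 2F * e 3F))
      (∣m∣n⇒∣m+n
        (∣-*-cong (g 0F * g 1F * g 2F) (e 0F * e 1F * e 2F) (g 3F) (e 3F)
          (∣-*-cong (g 0F * g 1F) (e 0F * e 1F) (g 2F) (e 2F)
            (∣-*-cong (g 0F) (e 0F) (g 1F) (e 1F) (residue 0F) (residue 1F)) (residue 2F)) (residue 3F))
        (∣-product-off-diagonal (λ i → φ (u i)) (λ i → ψ (u i)) λ i j i≢j →
          subst (+ D ∣_) (negate (φ (u i) · ψ (u j)))
            (∣m⇒∣-m (subst (λ b → + D ∣ + 8 * b - φ (u i) · ψ (u j)) (off-diagonal i j i≢j) (B-residue (u i) (u j))))))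
      where
      g e : Fin 4 → ℤ
      g i = + 8 * B (u i) (u i)
      e i = φ (u i) · ψ (u i)
      residue : ∀ i → + D ∣ g i - e i
      residue i = B-residue (u i) (u i)
      off-diagonal : ∀ i j → i ≢ j → B (u i) (u j) ≡ + 0
      off-diagonal i j i≢j with FinP.<-cmp i j
      ... | tri< i<j _ _ = trans (B-sym (u i) (u j)) (orth i j i<j)
      ... | tri≈ _ i≡j _ = contradiction i≡j i≢j
      ... | tri> _ _ j<i = orth j i j<i
      cancel : ∀ a b → a - b + b ≡ a
      cancel = solve-∀
      negate : ∀ a → - (+ 8 * + 0 - a) ≡ a
      negate = solve-∀

    -- Orthogonalisation and escalation

    B-combine : ∀ a v b w x → B (a ⊙ v ⊕ b ⊙ w) x ≡ a * B v x + b * B w x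
    B-combine a v b w x = trans (B-⊕ (a ⊙ v) (b ⊙ w) x) (cong₂ _+_ (B-⊙ a v x) (B-⊙ b w x))

    B-combine₃ : ∀ a v b w c y x → B (a ⊙ v ⊕ b ⊙ w ⊕ c ⊙ y) x ≡ a * B v x + b * B w x + c * B y x
    B-combine₃ a v b w c y x = trans (B-⊕ (a ⊙ v ⊕ b ⊙ w) (c ⊙ y) x) (cong₂ _+_ (B-combine a v b w x) (B-⊙ c y x))

    B-combine₄ : ∀ a v b w c y d z x → B (a ⊙ v ⊕ b ⊙ w ⊕ c ⊙ y ⊕ d ⊙ z) x ≡ a * B v x + b * B w x + c * B y x + d * B z x
    B-combine₄ a v b w c y d z x = trans (B-⊕ (a ⊙ v ⊕ b ⊙ w ⊕ c ⊙ y) (d ⊙ z) x)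
      (cong₂ _+_ (B-combine₃ a v b w c y x) (B-⊙ d z x))

    module Pair {v₁ v₂} (B₁₁ : B v₁ v₁ ≡ + 2) (B₂₂ : B v₂ v₂ ≡ + 4) where
      b σ : ℤ
      b = B v₁ v₂
      σ = + 8 - b * b

      -- Twice the component of `v₂` orthogonal to `v₁`.
      u₂ : V
      u₂ = + 2 ⊙ v₂ ⊕ (- b) ⊙ v₁

      Bu₂v₁ : B u₂ v₁ ≡ + 0
      Bu₂v₁ = trans (B-combine (+ 2) v₂ (- b) v₁ v₁)
        (trans (cong₂ (λ p q → + 2 * p + - b * q) (B-sym v₂ v₁) B₁₁) (identity b))
        where
        identity : ∀ b → + 2 * b + - b * + 2 ≡ + 0
        identity = solve-∀

      Bu₂v₂ : B u₂ v₂ ≡ σ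
      Bu₂v₂ = trans (B-combine (+ 2) v₂ (- b) v₁ v₂) (trans (cong (λ p → + 2 * p + - b * b) B₂₂) (identity b))
        where
        identity : ∀ b → + 8 + - b * b ≡ + 8 - b * b
        identity = solve-∀

      Bu₂u₂ : B u₂ u₂ ≡ + 2 * σ
      Bu₂u₂ = trans (B-combine (+ 2) v₂ (- b) v₁ u₂)
        (trans (cong₂ (λ p q → + 2 * p + - b * q) (trans (B-sym v₂ u₂) Bu₂v₂) (trans (B-sym v₁ u₂) Bu₂v₁)) (identity b σ))
        where
        identity : ∀ b σ → + 2 * σ + - b * + 0 ≡ + 2 * σ
        identity = solve-∀

      module Triple {v₃ t} (B₃₃ : B v₃ v₃ ≡ + 2 * + t) where
        c f μ : ℤ
        c = B v₁ v₃
        f = B v₂ v₃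
        -- Half the Gram determinant of `v₁`, `v₂`, `v₃`.
        μ = σ * + t + b * c * f - + 2 * (c * c) - f * f

        -- This is σ times the component of `v₃` orthogonal to `v₁` and `v₂`; the coefficients are
        -- cofactors of the Gram matrix.
        u₃ : V
        u₃ = σ ⊙ v₃ ⊕ (b * f - + 4 * c) ⊙ v₁ ⊕ (b * c - + 2 * f) ⊙ v₂

        Bu₃ : ∀ {x p q r} → B v₃ x ≡ p → B v₁ x ≡ q → B v₂ x ≡ r →
          B u₃ x ≡ σ * p + (b * f - + 4 * c) * q + (b * c - + 2 * f) * r
        Bu₃ refl refl refl = B-combine₃ σ v₃ (b * f - + 4 * c) v₁ (b * c - + 2 * f) v₂ _

        Bu₃v₁ : B u₃ v₁ ≡ + 0
        Bu₃v₁ = trans (Bu₃ (B-sym v₃ v₁) B₁₁ (B-sym v₂ v₁)) (identity b c f)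
          where
          identity : ∀ b c f → (+ 8 - b * b) * c + (b * f - + 4 * c) * + 2 + (b * c - + 2 * f) * b ≡ + 0
          identity = solve-∀

        Bu₃v₂ : B u₃ v₂ ≡ + 0
        Bu₃v₂ = trans (Bu₃ (B-sym v₃ v₂) refl B₂₂) (identity b c f)
          where
          identity : ∀ b c f → (+ 8 - b * b) * f + (b * f - + 4 * c) * b + (b * c - + 2 * f) * + 4 ≡ + 0
          identity = solve-∀

        Bu₃v₃ : B u₃ v₃ ≡ + 2 * μ
        Bu₃v₃ = trans (Bu₃ B₃₃ refl refl) (identity b c f σ (+ t))
          where
          identity : ∀ b c f σ t → σ * (+ 2 * t) + (b * f - + 4 * c) * c + (b * c - + 2 * f) * f
            ≡ + 2 * (σ * t + b * c * f - + 2 * (c * c) - f * f)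
          identity = solve-∀

        Bu₃u₂ : B u₃ u₂ ≡ + 0
        Bu₃u₂ = trans (B-sym u₃ u₂) (trans (B-combine (+ 2) v₂ (- b) v₁ u₃)
          (trans (cong₂ (λ p q → + 2 * p + - b * q) (trans (B-sym v₂ u₃) Bu₃v₂) (trans (B-sym v₁ u₃) Bu₃v₁)) (identity b)))
          where
          identity : ∀ b → + 2 * + 0 + - b * + 0 ≡ + 0
          identity = solve-∀

        Bu₃u₃ : B u₃ u₃ ≡ + 2 * σ * μ
        Bu₃u₃ = trans (Bu₃ (trans (B-sym v₃ u₃) Bu₃v₃) (trans (B-sym v₁ u₃) Bu₃v₁) (trans (B-sym v₂ u₃) Bu₃v₂))
          (identity σ μ (b * f - + 4 * c) (b * c - + 2 * f))
          where
          identity : ∀ σ μ x y → σ * (+ 2 * μ) + x * + 0 + y * + 0 ≡ + 2 * σ * μ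
          identity = solve-∀

        -- Completing the square in f brings μ into the form over which `Escalates` quantifies; 2 f
        -- - b c is the product of `u₂` with `v₃`.
        μ-complete-square : σ * (c * c) + ((+ 2 * f - b * c) * (+ 2 * f - b * c) + μ * + 4) ≡ + 4 * σ * + t
        μ-complete-square = identity b c f (+ t)
          where
          identity : ∀ b c f t → (+ 8 - b * b) * (c * c) + ((+ 2 * f - b * c) * (+ 2 * f - b * c)
            + ((+ 8 - b * b) * t + b * c * f - + 2 * (c * c) - f * f) * + 4) ≡ + 4 * (+ 8 - b * b) * t
          identity = solve-∀

        module Quadruple {v₄ t′} (B₄₄ : B v₄ v₄ ≡ + 2 * + t′) where
          e₁ e₂ e₃ ρ : ℤ
          e₁ = B v₄ v₁
          e₂ = B v₄ u₂
          e₃ = B v₄ u₃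
          -- This is σ times the Gram determinant of `v₁`, ..., `v₄`.
          ρ = + 4 * σ * μ * + t′ - σ * μ * (e₁ * e₁) - μ * (e₂ * e₂) - e₃ * e₃

          -- The norms 2, 2σ and 2σμ of the vectors projected out all divide 2σμ, so this one
          -- multiplier clears every denominator.
          u₄ : V
          u₄ = (+ 2 * σ * μ) ⊙ v₄ ⊕ (- (σ * μ * e₁)) ⊙ v₁ ⊕ (- (μ * e₂)) ⊙ u₂ ⊕ (- e₃) ⊙ u₃

          Bu₄ : ∀ {x p q r s} → B v₄ x ≡ p → B v₁ x ≡ q → B u₂ x ≡ r → B u₃ x ≡ s →
            B u₄ x ≡ + 2 * σ * μ * p + - (σ * μ * e₁) * q + - (μ * e₂) * r + - e₃ * s
          Bu₄ refl refl refl refl = B-combine₄ (+ 2 * σ * μ) v₄ (- (σ * μ * e₁)) v₁ (- (μ * e₂)) u₂ (- e₃) u₃ _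

          Bu₄v₁ : B u₄ v₁ ≡ + 0
          Bu₄v₁ = trans (Bu₄ refl B₁₁ Bu₂v₁ Bu₃v₁) (identity σ μ e₁ (- (μ * e₂)) (- e₃))
            where
            identity : ∀ σ μ e x y → + 2 * σ * μ * e + - (σ * μ * e) * + 2 + x * + 0 + y * + 0 ≡ + 0
            identity = solve-∀

          Bu₄u₂ : B u₄ u₂ ≡ + 0
          Bu₄u₂ = trans (Bu₄ refl (trans (B-sym v₁ u₂) Bu₂v₁) Bu₂u₂ Bu₃u₂) (identity σ μ e₂ (- (σ * μ * e₁)) (- e₃))
            where
            identity : ∀ σ μ e x y → + 2 * σ * μ * e + x * + 0 + - (μ * e) * (+ 2 * σ) + y * + 0 ≡ + 0
            identity = solve-∀

          Bu₄u₃ : B u₄ u₃ ≡ + 0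
          Bu₄u₃ = trans (Bu₄ refl (trans (B-sym v₁ u₃) Bu₃v₁) (trans (B-sym u₂ u₃) Bu₃u₂) Bu₃u₃)
            (identity σ μ e₃ (- (σ * μ * e₁)) (- (μ * e₂)))
            where
            identity : ∀ σ μ e x y → + 2 * σ * μ * e + x * + 0 + y * + 0 + - e * (+ 2 * σ * μ) ≡ + 0
            identity = solve-∀

          Bu₄v₄ : B u₄ v₄ ≡ ρ
          Bu₄v₄ = trans (Bu₄ B₄₄ (B-sym v₁ v₄) (B-sym u₂ v₄) (B-sym u₃ v₄)) (identity σ μ (+ t′) e₁ e₂ e₃)
            where
            identity : ∀ σ μ t e₁ e₂ e₃ → + 2 * σ * μ * (+ 2 * t) + - (σ * μ * e₁) * e₁ + - (μ * e₂) * e₂ + - e₃ * e₃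
              ≡ + 4 * σ * μ * t - σ * μ * (e₁ * e₁) - μ * (e₂ * e₂) - e₃ * e₃
            identity = solve-∀

          Bu₄u₄ : B u₄ u₄ ≡ + 2 * σ * μ * ρ
          Bu₄u₄ = trans (Bu₄ (trans (B-sym v₄ u₄) Bu₄v₄) (trans (B-sym v₁ u₄) Bu₄v₁)
              (trans (B-sym u₂ u₄) Bu₄u₂) (trans (B-sym u₃ u₄) Bu₄u₃))
            (identity (+ 2 * σ * μ * ρ) (- (σ * μ * e₁)) (- (μ * e₂)) (- e₃))
            where
            identity : ∀ a x y z → a + x * + 0 + y * + 0 + z * + 0 ≡ a
            identity = solve-∀

          ∣-discriminant : + D ∣ + 8 * + 2 * (+ 8 * (+ 2 * σ)) * (+ 8 * (+ 2 * σ * μ)) * (+ 8 * (+ 2 * σ * μ * ρ))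
          ∣-discriminant = subst (+ D ∣_)
            (cong₂ _*_ (cong₂ _*_ (cong₂ _*_ (cong (+ 8 *_) B₁₁) (cong (+ 8 *_) Bu₂u₂)) (cong (+ 8 *_) Bu₃u₃)) (cong (+ 8 *_) Bu₄u₄))
            (orthogonal⇒∣ u orthogonal)
            where
            u : Fin 4 → V
            u 0F = v₁
            u 1F = u₂
            u 2F = u₃
            u 3F = u₄
            orthogonal : ∀ i j → i Fin.< j → B (u j) (u i) ≡ + 0
            orthogonal 0F 1F _ = Bu₂v₁
            orthogonal 0F 2F _ = Bu₃v₁
            orthogonal 0F 3F _ = Bu₄v₁
            orthogonal 1F 2F _ = Bu₃u₂
            orthogonal 1F 3F _ = Bu₄u₂
            orthogonal 2F 3F _ = Bu₄u₃
            orthogonal 1F 1F (ℕ.s≤s ())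
            orthogonal 2F 1F (ℕ.s≤s ())
            orthogonal 3F 1F (ℕ.s≤s ())
            orthogonal 2F 2F (ℕ.s≤s (ℕ.s≤s ()))
            orthogonal 3F 2F (ℕ.s≤s (ℕ.s≤s ()))
            orthogonal 3F 3F (ℕ.s≤s (ℕ.s≤s (ℕ.s≤s ())))

          bounded₄ : ∀ {s M} → + s ≡ σ → + M ≡ μ → 1 ℕ.≤ s → s ℕ.≤ 8 → 1 ℕ.≤ M → M ℕ.≤ 40 → t′ ℕ.≤ 115 →
            (∀ x y z w → s ℕ.* (x ℕ.* x) ℕ.+ (y ℕ.* y ℕ.+ w) ≡ 4 ℕ.* s ℕ.* t′ → z ℕ.* z ≢ M ℕ.* w) →
            D ℕ.≤ discriminant 8 40 147200
          bounded₄ {s} {M} s≡σ M≡μ 1≤s s≤8 1≤M M≤40 t′≤115 missed = ℕP.≤-trans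
            -- Divisibility bounds D only if the discriminant is nonzero; comparison with its value
            -- at 1, 1, 1 shows this.
            (ℕD.∣⇒≤ {{ℕ.>-nonZero (ℕP.≤-trans (ℕP.≤ᵇ⇒≤ 1 (discriminant 1 1 1) tt) (discriminant-mono 1≤s 1≤M 1≤r))}}
              (∣⇒∣ᵤ (subst (+ D ∣_) discriminant≡ ∣-discriminant)))
            (discriminant-mono s≤8 M≤40 r≤147200)
            where
            0≤ρ : + 0 ℤ.≤ ρ
            0≤ρ = 0≤-cancel (ℕP.*-mono-≤ (ℕP.*-mono-≤ (ℕP.≤ᵇ⇒≤ 1 2 tt) 1≤s) 1≤M)
              (subst (+ 0 ℤ.≤_) (trans Bu₄u₄ (cong (_* ρ) (sym (trans (ℤP.pos-* (2 ℕ.* s) M)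
                (cong₂ _*_ (trans (ℤP.pos-* 2 s) (cong (+ 2 *_) s≡σ)) M≡μ))))) (B-nonneg u₄))
            r : ℕ
            r = proj₁ (0≤⇒+ 0≤ρ)
            r≡ρ : + r ≡ ρ
            r≡ρ = proj₂ (0≤⇒+ 0≤ρ)
            discriminant≡ : + 8 * + 2 * (+ 8 * (+ 2 * σ)) * (+ 8 * (+ 2 * σ * μ)) * (+ 8 * (+ 2 * σ * μ * ρ)) ≡ + discriminant s M r
            discriminant≡ = trans (sym (substitute s≡σ M≡μ r≡ρ)) (sym (pos-discriminant s M r))
              where
              substitute : ∀ {a b c x y z} → a ≡ x → b ≡ y → c ≡ z →
                + 8 * + 2 * (+ 8 * (+ 2 * a)) * (+ 8 * (+ 2 * a * b)) * (+ 8 * (+ 2 * a * b * c))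
                ≡ + 8 * + 2 * (+ 8 * (+ 2 * x)) * (+ 8 * (+ 2 * x * y)) * (+ 8 * (+ 2 * x * y * z))
              substitute refl refl refl = refl
            -- Since ρ = μ w - e₃², the vanishing of ρ is the equation z² = M w that the search
            -- excluded.
            w : ℤ
            w = + 4 * σ * + t′ - σ * (e₁ * e₁) - e₂ * e₂
            ρ≢0 : ρ ≢ + 0
            ρ≢0 ρ≡0 = missed (∣ e₁ ∣) (∣ e₂ ∣) (∣ e₃ ∣) W
              (scaled-square-sum {s} {t′} {W} {σ} {e₁} {e₂} s≡σ W≡w (complete (+ 4 * σ * + t′) (σ * (e₁ * e₁)) (e₂ * e₂)))
              (ℤP.+-injective (begin
                + (∣ e₃ ∣ ℕ.* ∣ e₃ ∣) ≡⟨ e₃²≡Mw ⟩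
                + M * w               ≡⟨ cong (+ M *_) W≡w ⟨
                + M * + W             ≡⟨ ℤP.pos-* M W ⟨
                + (M ℕ.* W)           ∎))
              where
              open ≡-Reasoning
              complete : ∀ a b c → b + (c + (a - b - c)) ≡ a
              complete = solve-∀
              factor : ∀ σ μ t e₁ e₂ e₃ → + 4 * σ * μ * t - σ * μ * (e₁ * e₁) - μ * (e₂ * e₂) - e₃ * e₃ + e₃ * e₃
                ≡ μ * (+ 4 * σ * t - σ * (e₁ * e₁) - e₂ * e₂)
              factor = solve-∀
              e₃²≡Mw : + (∣ e₃ ∣ ℕ.* ∣ e₃ ∣) ≡ + M * w
              e₃²≡Mw = begin
                + (∣ e₃ ∣ ℕ.* ∣ e₃ ∣) ≡⟨ i*i≡+∣i∣*∣i∣ e₃ ⟨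
                e₃ * e₃               ≡⟨ ℤP.+-identityˡ (e₃ * e₃) ⟨
                + 0 + e₃ * e₃         ≡⟨ cong (λ k → k + e₃ * e₃) ρ≡0 ⟨
                ρ + e₃ * e₃           ≡⟨ factor σ μ (+ t′) e₁ e₂ e₃ ⟩
                μ * w                 ≡⟨ cong (_* w) M≡μ ⟨
                + M * w               ∎
              0≤w : + 0 ℤ.≤ w
              0≤w = 0≤-cancel 1≤M (subst (+ 0 ℤ.≤_) e₃²≡Mw (ℤ.+≤+ ℕ.z≤n))
              W : ℕ
              W = proj₁ (0≤⇒+ 0≤w)
              W≡w : + W ≡ w
              W≡w = proj₂ (0≤⇒+ 0≤w)
            1≤r : 1 ℕ.≤ r
            1≤r = ℕP.n≢0⇒n>0 λ r≡0 → ρ≢0 (trans (sym r≡ρ) (cong +_ r≡0))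
            -- The squares subtracted in ρ: r + P = 4 s M t′ exactly, which gives r ≤ 4 · 8 · 40 ·
            -- 115 = 147200.
            P : ℕ
            P = s ℕ.* M ℕ.* (∣ e₁ ∣ ℕ.* ∣ e₁ ∣) ℕ.+ M ℕ.* (∣ e₂ ∣ ℕ.* ∣ e₂ ∣) ℕ.+ ∣ e₃ ∣ ℕ.* ∣ e₃ ∣
            r≤147200 : r ℕ.≤ 147200
            r≤147200 = ℕP.≤-trans (ℕP.m≤m+n r P) (ℕP.≤-trans (ℕP.≤-reflexive (ℤP.+-injective r+P≡))
              (ℕP.*-mono-≤ (ℕP.*-mono-≤ (ℕP.*-monoʳ-≤ 4 s≤8) M≤40) t′≤115))
              where
              open ≡-Reasoning
              cancel : ∀ a x y z → a - x - y - z + (x + y + z) ≡ a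
              cancel = solve-∀
              sM : + (s ℕ.* M) ≡ σ * μ
              sM = trans (ℤP.pos-* s M) (cong₂ _*_ s≡σ M≡μ)
              P≡ : + P ≡ σ * μ * (e₁ * e₁) + μ * (e₂ * e₂) + e₃ * e₃
              P≡ = cong₂ _+_ (cong₂ _+_
                (trans (ℤP.pos-* (s ℕ.* M) _) (cong₂ _*_ sM (sym (i*i≡+∣i∣*∣i∣ e₁))))
                (trans (ℤP.pos-* M _) (cong₂ _*_ M≡μ (sym (i*i≡+∣i∣*∣i∣ e₂)))))
                (sym (i*i≡+∣i∣*∣i∣ e₃))
              r+P≡ : + r + + P ≡ + (4 ℕ.* s ℕ.* M ℕ.* t′)
              r+P≡ = begin
                + r + + P                                                ≡⟨ cong₂ _+_ r≡ρ P≡ ⟩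
                ρ + (σ * μ * (e₁ * e₁) + μ * (e₂ * e₂) + e₃ * e₃)        ≡⟨ cancel (+ 4 * σ * μ * + t′) (σ * μ * (e₁ * e₁)) (μ * (e₂ * e₂)) (e₃ * e₃) ⟩
                + 4 * σ * μ * + t′                                       ≡⟨ cong₂ (λ x y → + 4 * x * y * + t′) s≡σ M≡μ ⟨
                + 4 * + s * + M * + t′                                   ≡⟨ cong (λ k → k * + M * + t′) (ℤP.pos-* 4 s) ⟨
                + (4 ℕ.* s) * + M * + t′                                 ≡⟨ cong (_* + t′) (ℤP.pos-* (4 ℕ.* s) M) ⟨
                + (4 ℕ.* s ℕ.* M) * + t′                                 ≡⟨ ℤP.pos-* (4 ℕ.* s ℕ.* M) t′ ⟨
                + (4 ℕ.* s ℕ.* M ℕ.* t′)                                 ∎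

        bounded₃ : ∀ {s} → + s ≡ σ → 1 ℕ.≤ s → s ℕ.≤ 8 → t ℕ.≤ 5 → Escalates s t → D ℕ.≤ discriminant 8 40 147200
        bounded₃ {s} s≡σ 1≤s s≤8 t≤5 escalates =
          let 1≤M , t′ , 1≤t′ , t′≤115 , missed = escalates (∣ c ∣) (∣ + 2 * f - b * c ∣) M equation
              v₄ , B₄₄ = B-universal t′ 1≤t′
          in Quadruple.bounded₄ {v₄} B₄₄ s≡σ M≡μ 1≤s s≤8 1≤M M≤40 t′≤115 missed
          where
          0≤μ : + 0 ℤ.≤ μ
          0≤μ = 0≤-cancel (ℕP.*-mono-≤ (ℕP.≤ᵇ⇒≤ 1 2 tt) 1≤s)
            (subst (+ 0 ℤ.≤_) (trans Bu₃u₃ (cong (_* μ) (sym (trans (ℤP.pos-* 2 s) (cong (+ 2 *_) s≡σ))))) (B-nonneg u₃))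
          M : ℕ
          M = proj₁ (0≤⇒+ 0≤μ)
          M≡μ : + M ≡ μ
          M≡μ = proj₂ (0≤⇒+ 0≤μ)
          equation : s ℕ.* (∣ c ∣ ℕ.* ∣ c ∣) ℕ.+ (∣ + 2 * f - b * c ∣ ℕ.* ∣ + 2 * f - b * c ∣ ℕ.+ M ℕ.* 4) ≡ 4 ℕ.* s ℕ.* t
          equation = scaled-square-sum {s} {t} {M ℕ.* 4} {σ} {c} {+ 2 * f - b * c} s≡σ (trans (ℤP.pos-* M 4) (cong (_* + 4) M≡μ)) μ-complete-square
          -- Dropping the two squares leaves 4 M ≤ 4 s t ≤ 4 · 8 · 5.
          M≤40 : M ℕ.≤ 40
          M≤40 = ℕP.*-cancelʳ-≤ M 40 4 (ℕP.≤-trans (ℕP.m≤n+m (M ℕ.* 4) (s ℕ.* (∣ c ∣ ℕ.* ∣ c ∣) ℕ.+ ∣ + 2 * f - b * c ∣ ℕ.* ∣ + 2 * f - b * c ∣))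
            (ℕP.≤-trans (ℕP.≤-reflexive (trans (ℕP.+-assoc (s ℕ.* (∣ c ∣ ℕ.* ∣ c ∣)) _ (M ℕ.* 4)) equation)) (ℕP.*-mono-≤ (ℕP.*-monoʳ-≤ 4 s≤8) t≤5)))

      bounded₂ : D ℕ.≤ discriminant 8 40 147200
      bounded₂ =
        let s , t , s≡σ , 1≤s , s≤8 , 1≤t , t≤5 , escalates = escalation₂ b (subst (+ 0 ℤ.≤_) Bu₂u₂ (B-nonneg u₂))
            v₃ , B₃₃ = B-universal t 1≤t
        in Triple.bounded₃ {v₃} B₃₃ s≡σ 1≤s s≤8 t≤5 escalates

    bounded : D ℕ.≤ discriminant 8 40 147200
    bounded = Pair.bounded₂ (proj₂ (B-universal 1 ℕP.≤-refl)) (proj₂ (B-universal 2 (ℕP.≤ᵇ⇒≤ 1 2 tt)))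

theorem1p4 : ∃[ B ] ∀ (D : ℕ) → 2 ≤ D → SquareFree D →
    (AdmitsZUniversal D 2 ⊎ AdmitsZUniversal D 3) → D ≤ B
theorem1p4 = Escalation.discriminant 8 40 147200 , λ D _ _ →
  [ (λ (G , univ) → Escalation.bounded (pad (Field.lattice D (Field.sumTriMask₂ D) G univ)))
  , (λ (G , univ) → Escalation.bounded (Field.lattice D (Field.sumTriMask₃ D) G univ)) ]′
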